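{- For any graph $G$ and any integer $t\ge 3$, $\mathsf{mmbs}_t(G) \le \beta(\mathsf{bed}^+_t(G),t)$, where $\beta(0,t)=1$ and $\beta(x,t)=2^{t\,\beta(x-1,t)}$ for $x\ge1$ (so $\beta(1,t)=2^t$, $\beta(2,t)=2^{t2^t}$, etc., a tower of height $x$).
   Context: Fix $t\ge3$. A $t$-clique is a set of $t$ pairwise adjacent vertices. For a graph $G$, $\mathrm{opt}(G)$ is the minimum size of a set intersecting every $t$-clique of $G$. An instance of Extended $K_t$-Hitting is a pair $(G,\mathcal F)$ where $\mathcal F$ is a set of subsets $Z\subseteq V(G)$ with $1\le|Z|\le t-1$ and $G[Z]$ a clique; $\mathrm{opt}(G,\mathcal F)$ is the minimum size of a set intersecting every $t$-clique of $G$ and every $Z\in\mathcal F$. $(G,\mathcal F)$ is clean if $\mathrm{opt}(G,\mathcal F)=\mathrm{opt}(G)$. A blocking set of $(G,\mathcal F)$ is a set $\mathcal B$ of subsets $B\subseteq V(G)$ with $1\le|B|\le t-1$ and $G[B]$ a clique, such that $\mathrm{opt}(G,\mathcal F\cup\mathcal B)>\mathrm{opt}(G,\mathcal F)$. $\mathsf{mmbs}_t(G,\mathcal F)$ is the maximum size of an inclusion-wise minimal blocking set of $(G,\mathcal F)$, and $\mathsf{mmbs}_t(G)$ is the maximum of $\mathsf{mmbs}_t(G,\mathcal F)$ over all clean instances $(G,\mathcal F)$. For a connected graph $G$, a root is a nonempty $T\subseteq V(G)$ with $G[T]$ connected and $K_t$-free such that each connected component $C$ of $G-T$ has $|N(C)\cap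 T|=1$. $\mathsf{bed}^+_t(G)$ is defined recursively: $0$ if $V(G)=\emptyset$; $\mathsf{bed}^+_t(G-v)$ if $v$ lies in no $t$-clique of $G$; $\max_i\mathsf{bed}^+_t(C_i)$ if $G$ has connected components $C_1,\dots,C_c$, $c\ge2$; otherwise $1+\min_T\mathsf{bed}^+_t(G-T)$ over all roots $T$ of $G$. -}

module Defs where

open import Data.Nat using (ℕ; zero; suc; _≤_; _<_; _^_; _*_)
open import Data.Bool using (Bool; true; false; T)
open import Data.Fin using (Fin)
open import Data.Fin.Subset using (Subset; _∈_; _∉_; _⊆_; _∩_; _─_; _-_; ∣_∣; Nonempty; Empty)
open import Data.List using (List; []; _++_)
open import Data.List.Membership.Propositional using () renaming (_∈_ to _∈ˡ_)
open import Data.List.Relation.Unary.All using (All)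
open import Data.Product using (Σ; ∃; _×_; _,_)
open import Relation.Nullary using (¬_)
open import Relation.Binary.PropositionalEquality using (_≡_; _≢_)

record Graph (n : ℕ) : Set where
  field
    adj    : Fin n → Fin n → Bool
    sym    : ∀ u v → adj u v ≡ adj v u
    irrefl : ∀ v → adj v v ≡ false

module _ {n : ℕ} (G : Graph n) where
  open Graph G

  Edge : Fin n → Fin n → Set
  Edge u v = T (adj u v)

  IsClique : Subset n → Set
  IsClique K = ∀ u v → u ∈ K → v ∈ K → u ≢ v → Edge u v

  TClique : ℕ → Subset n → Set
  TClique t K = IsClique K × ∣ K ∣ ≡ t

  Hits : Subset n → Subset n → Set
  Hits S X = Nonempty (S ∩ X)

  HitsAll : ℕ → List (Subset n) → Subset n → Set
  HitsAll t F S = (∀ K → TClique t K → Hits S K) × (∀ Z → Z ∈ˡ F → Hits S Z)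

  OptIs : ℕ → List (Subset n) → ℕ → Set
  OptIs t F k = (∃ λ S → HitsAll t F S × ∣ S ∣ ≡ k)
              × (∀ S → HitsAll t F S → k ≤ ∣ S ∣)

  ValidFamily : ℕ → List (Subset n) → Set
  ValidFamily t F = All (λ Z → 1 ≤ ∣ Z ∣ × ∣ Z ∣ < t × IsClique Z) F

  Clean : ℕ → List (Subset n) → Set
  Clean t F = ValidFamily t F × (∃ λ k → OptIs t F k × OptIs t [] k)

  Blocking : ℕ → List (Subset n) → List (Subset n) → Set
  Blocking t F B = ValidFamily t B
                 × (∃ λ k → ∃ λ k' → OptIs t F k × OptIs t (F ++ B) k' × k < k')

  _⊆ˡ_ : List (Subset n) → List (Subset n) → Set
  B' ⊆ˡ B = ∀ Z → Z ∈ˡ B' → Z ∈ˡ B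

  MinimalBlocking : ℕ → List (Subset n) → List (Subset n) → Set
  MinimalBlocking t F B = Blocking t F B
                        × (∀ B' → B' ⊆ˡ B → Blocking t F B' → B ⊆ˡ B')

  data PathIn (U : Subset n) : Fin n → Fin n → Set where
    here  : ∀ {u} → u ∈ U → PathIn U u u
    there : ∀ {u w v} → u ∈ U → Edge u w → PathIn U w v → PathIn U u v

  Connected : Subset n → Set
  Connected U = ∀ u v → u ∈ U → v ∈ U → PathIn U u v

  Component : Subset n → Subset n → Set
  Component U C = C ⊆ U × Nonempty C × Connected C
                × (∀ u v → u ∈ C → v ∈ U → Edge u v → v ∈ C)

  InTClique : ℕ → Subset n → Fin n → Set
  InTClique t U v = ∃ λ K → K ⊆ U × TClique t K × v ∈ K

  KtFree : ℕ → Subset n → Set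
  KtFree t X = ∀ K → K ⊆ X → ¬ TClique t K

  OneNeighbourIn : Subset n → Subset n → Set
  OneNeighbourIn C X =
    ∃ λ x → (x ∈ X × x ∉ C × ∃ λ c → c ∈ C × Edge c x)
          × (∀ y → y ∈ X → y ∉ C → (∃ λ c → c ∈ C × Edge c y) → y ≡ x)

  Root : ℕ → Subset n → Subset n → Set
  Root t U X = X ⊆ U × Nonempty X × Connected X × KtFree t X
             × (∀ C → Component (U ─ X) C → OneNeighbourIn C X)

  -- BedLe t U k  :⇔  bed⁺_t(G[U]) ≤ k   (following the recursive definition;
  -- the cases are made mutually exclusive exactly as in the "otherwise" clauses)
  data BedLe (t : ℕ) : Subset n → ℕ → Set where
    empty : ∀ {U k} → Empty U → BedLe t U k
    del   : ∀ {U k} v → v ∈ U → ¬ InTClique t U v → BedLe t (U - v) k → BedLe t U k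
    split : ∀ {U k} → Nonempty U → (∀ v → v ∈ U → InTClique t U v) → ¬ Connected U
          → (∀ C → Component U C → BedLe t C k) → BedLe t U k
    root  : ∀ {U k} X → Nonempty U → (∀ v → v ∈ U → InTClique t U v) → Connected U
          → Root t U X → BedLe t (U ─ X) k → BedLe t U (suc k)

  BedIs : ℕ → Subset n → ℕ → Set
  BedIs t U x = BedLe t U x × (∀ y → BedLe t U y → x ≤ y)

β : ℕ → ℕ → ℕ
β zero    t = 1
β (suc x) t = 2 ^ (t * β x t)

{-# OPTIONS --safe #-}

-- Fix H = {t-cliques} ∪ F ∪ B.  It suffices to extract from H few sets that already force the cost
-- opt(G) + 1; those of them that lie in B then form a blocking set.  The induction on bed⁺ needs more:
-- for every excess j, few sets of H force cost opt(U) + j on U, whatever has been chosen outside U.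
-- Vertices in no t-clique: a solution either avoids them, or it spends a unit of the excess on one
-- of the boundedly many such vertices in the sets extracted for the solutions that avoid them.
-- Roots X: each x ∈ X and the components hanging at x form a part, and every t-clique lies in one
-- part or in an unattached component.  If x is expensive both inside and outside the solution, branch
-- on x; otherwise some Z ∈ H meets U only in X, in vertices that are expensive inside, so branch on
-- the vertex of Z that is chosen.  Each branch leaves an excess < j for the other parts and an excess
-- ≤ j + 1 for the components at x, whose depth is one less.
module Submission where

open import Defs
open import Algebra.Properties.CommutativeSemigroup using (interchange)
open import Data.Bool as Bool using (true; false; T)
open import Data.Bool.Properties using (T?)
open import Data.Fin using (Fin; zero; suc)
import Data.Fin.Properties as Fin
open import Data.Fin.Subset
open import Data.Fin.Subset.Properties
open import Data.List using (List; []; _∷_; _++_; length; filter; allFin)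
open import Data.List.Properties using (length-++; length-filter)
import Data.List.Membership.DecPropositional as DecMembership
open import Data.List.Membership.Propositional using (find) renaming (_∈_ to _∈ˡ_)
open import Data.List.Membership.Propositional.Properties
  using (∈-++⁺ˡ; ∈-++⁺ʳ; ∈-++⁻; ∈-∃++; ∈-filter⁺; ∈-filter⁻; ∈-allFin)
import Data.List.Relation.Unary.All as All
import Data.List.Relation.Unary.All.Properties as All
open import Data.List.Relation.Unary.Any using (here; there)
open import Data.List.Relation.Unary.Unique.Propositional using (Unique; _∷_)
open import Data.List.Relation.Unary.Unique.Propositional.Properties using (Unique[x∷xs]⇒x∉xs)
open import Data.Maybe using (Maybe; just; nothing)
open import Data.Maybe.Properties using (≡-dec; just-injective)
open import Data.Nat
open import Data.Nat.Properties
open import Data.Nat.Solver using (module +-*-Solver)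
open import Data.Product using (∃; ∃₂; _×_; _,_; proj₁; proj₂)
open import Data.Sum using (_⊎_; inj₁; inj₂; [_,_]′)
open import Data.Vec using ([]; _∷_; tabulate; here; there)
open import Data.Vec.Properties as Vec using (lookup∘tabulate; lookup⇒[]=; []=⇒lookup)
open import Function using (id; _∘_; case_of_)
open import Relation.Binary.PropositionalEquality hiding (sym)
import Relation.Binary.PropositionalEquality as ≡
open import Relation.Nullary
open import Relation.Nullary.Decidable
  using (decidable-stable; _×-dec_; _⊎-dec_; _→-dec_; map′; dec-true; ¬¬-excluded-middle)
open import Relation.Unary using (Decidable)

-- No bound may depend on how often the recursion of bed⁺ splits or deletes, since both happen
-- unboundedly often. The recursion tree is therefore flattened into ranks: all vertices deleted at
-- one depth, over all components, share a rank, and so do all roots of one depth. A layer of roots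
-- is still K_t-free and each lower component still sees at most one of its vertices, so it acts as
-- a single root and the depth alone drives the outer induction. The t-cliques of `U` need not be
-- extracted, since every competitor has to hit them anyway. They force `opt U`; extracted sets only
-- pay for the excess. The optimum is additive over parts, so an extra unit located in one part
-- leaves one unit less for the others: this is the inner induction. The excess starts at 1, but
-- passing from a part to its components without `x` can hide a unit in `x`, so lower depths must
-- allow a larger excess. The exponents obtained grow only like `8 ^ k`, far below the tower; only
-- depths up to 2 need care.

private variable
  n : ℕ
  p q : Subset n
  v : Fin n

-- Finite subsets: counting and search

∈∪ˡ : v ∈ p → v ∈ p ∪ q
∈∪ˡ = x∈p∪q⁺ ∘ inj₁

∈∪ʳ : v ∈ q → v ∈ p ∪ q
∈∪ʳ = x∈p∪q⁺ ∘ inj₂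

∈∩⁻ : v ∈ p ∩ q → v ∈ p × v ∈ q
∈∩⁻ = x∈p∩q⁻ _ _

∈∪⁻ : v ∈ p ∪ q → v ∈ p ⊎ v ∈ q
∈∪⁻ = x∈p∪q⁻ _ _

∈─⁻ : v ∈ p ─ q → v ∈ p × v ∉ q
∈─⁻ {p = p} {q} v∈ = p─q⊆p p q v∈ , ∉ p q v∈
  where
  ∉ : ∀ {n} {v : Fin n} p q → v ∈ p ─ q → v ∉ q
  ∉ (_ ∷ p) (outside ∷ q) (there v∈) (there v∈q) = ∉ p q v∈ v∈q
  ∉ (_ ∷ p) (inside ∷ q) (there v∈) (there v∈q) = ∉ p q v∈ v∈q

∣p∩q∣+∣p─q∣≡∣p∣ : ∀ (p q : Subset n) → ∣ p ∩ q ∣ + ∣ p ─ q ∣ ≡ ∣ p ∣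
∣p∩q∣+∣p─q∣≡∣p∣ [] [] = refl
∣p∩q∣+∣p─q∣≡∣p∣ (outside ∷ p) (outside ∷ q) = ∣p∩q∣+∣p─q∣≡∣p∣ p q
∣p∩q∣+∣p─q∣≡∣p∣ (outside ∷ p) (inside ∷ q) = ∣p∩q∣+∣p─q∣≡∣p∣ p q
∣p∩q∣+∣p─q∣≡∣p∣ (inside ∷ p) (outside ∷ q) =
  trans (+-suc _ _) (cong suc (∣p∩q∣+∣p─q∣≡∣p∣ p q))
∣p∩q∣+∣p─q∣≡∣p∣ (inside ∷ p) (inside ∷ q) = cong suc (∣p∩q∣+∣p─q∣≡∣p∣ p q)

∣p∪q∣≤∣p∣+∣q∣ : ∀ (p q : Subset n) → ∣ p ∪ q ∣ ≤ ∣ p ∣ + ∣ q ∣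
∣p∪q∣≤∣p∣+∣q∣ [] [] = z≤n
∣p∪q∣≤∣p∣+∣q∣ (outside ∷ p) (outside ∷ q) = ∣p∪q∣≤∣p∣+∣q∣ p q
∣p∪q∣≤∣p∣+∣q∣ (outside ∷ p) (inside ∷ q) =
  ≤-trans (s≤s (∣p∪q∣≤∣p∣+∣q∣ p q)) (≤-reflexive (≡.sym (+-suc _ _)))
∣p∪q∣≤∣p∣+∣q∣ (inside ∷ p) (outside ∷ q) = s≤s (∣p∪q∣≤∣p∣+∣q∣ p q)
∣p∪q∣≤∣p∣+∣q∣ (inside ∷ p) (inside ∷ q) =
  s≤s (≤-trans (∣p∪q∣≤∣p∣+∣q∣ p q) (+-monoʳ-≤ ∣ p ∣ (n≤1+n _)))

∣p∪⁅x⁆∣≤1+∣p∣ : ∀ (p : Subset n) x → ∣ p ∪ ⁅ x ⁆ ∣ ≤ suc ∣ p ∣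
∣p∪⁅x⁆∣≤1+∣p∣ p x = ≤-trans (∣p∪q∣≤∣p∣+∣q∣ p ⁅ x ⁆)
  (≤-reflexive (trans (cong (∣ p ∣ +_) (∣⁅x⁆∣≡1 x)) (+-comm ∣ p ∣ 1)))

0<∣p∣⇒Nonempty : ∀ (p : Subset n) → 0 < ∣ p ∣ → Nonempty p
0<∣p∣⇒Nonempty {n} p 0<∣p∣ with nonempty? p
... | yes ne = ne
... | no ¬ne = contradiction (subst (λ p → 0 < ∣ p ∣) (Empty-unique ¬ne) 0<∣p∣)
                             (<-irrefl (≡.sym (∣⊥∣≡0 n)))

abstract
  comprehension : {P : Fin n → Set} → Decidable P → Subset n
  comprehension P? = tabulate (λ v → does (P? v))

  ∈-comprehension⁺ : {P : Fin n → Set} (P? : Decidable P) → P v → v ∈ comprehension P?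
  ∈-comprehension⁺ {v = v} P? Pv =
    lookup⇒[]= v _ (trans (lookup∘tabulate _ v) (dec-true (P? v) Pv))

  ∈-comprehension⁻ : {P : Fin n → Set} (P? : Decidable P) → v ∈ comprehension P? → P v
  ∈-comprehension⁻ {v = v} P? v∈ with P? v in eq
  ... | yes Pv = Pv
  ... | no _ = case trans (≡.sym ([]=⇒lookup v∈)) (trans (lookup∘tabulate _ v) (cong does eq)) of λ ()

allSubsets? : {P : Subset n → Set} → Decidable P → Dec (∀ S → P S)
allSubsets? P? = map′ (λ ¬∃ S → decidable-stable (P? S) (λ ¬PS → ¬∃ (S , ¬PS)))
                      (λ ∀P (S , ¬PS) → ¬PS (∀P S))
                      (¬? (anySubset? (¬? ∘ P?)))

¬∀⟶∃¬-Subset : {P : Subset n → Set} → Decidable P → ¬ (∀ S → P S) → ∃ λ S → ¬ P S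
¬∀⟶∃¬-Subset P? ¬∀ = decidable-stable (anySubset? (¬? ∘ P?))
  λ ¬∃ → ¬∀ λ S → decidable-stable (P? S) (λ ¬PS → ¬∃ (S , ¬PS))

-- Lets finitely many instances of excluded middle be assumed together under a stable goal; the
-- decider for paths is obtained this way.
¬¬-∀-Fin : {P : Fin n → Set} → (∀ i → ¬ ¬ P i) → ¬ ¬ (∀ i → P i)
¬¬-∀-Fin {zero} _ ¬∀ = ¬∀ λ ()
¬¬-∀-Fin {suc n} ¬¬P ¬∀ = ¬¬P zero λ P0 → ¬¬-∀-Fin (¬¬P ∘ suc) λ Ps →
  ¬∀ λ { zero → P0 ; (suc i) → Ps i }

¬¬-∀-Subset : {P : Subset n → Set} → (∀ S → ¬ ¬ P S) → ¬ ¬ (∀ S → P S)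
¬¬-∀-Subset {zero} ¬¬P ¬∀ = ¬¬P [] λ P[] → ¬∀ λ { [] → P[] }
¬¬-∀-Subset {suc n} ¬¬P ¬∀ =
  ¬¬-∀-Subset (¬¬P ∘ (inside ∷_)) λ Pi →
  ¬¬-∀-Subset (¬¬P ∘ (outside ∷_)) λ Po →
  ¬∀ λ { (true ∷ S) → Pi S ; (false ∷ S) → Po S }

smallest : {P : Subset n → Set} → Decidable P → ∃ P →
           ∃ λ S → P S × (∀ S′ → P S′ → ∣ S ∣ ≤ ∣ S′ ∣)
smallest {P = P} P? (S , PS) = go ∣ S ∣ S PS ≤-refl
  where
  go : ∀ k S → P S → ∣ S ∣ ≤ k → ∃ λ S → P S × (∀ S′ → P S′ → ∣ S ∣ ≤ ∣ S′ ∣)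
  go k S PS ∣S∣≤k with anySubset? (λ S′ → P? S′ ×-dec (∣ S′ ∣ <? ∣ S ∣))
  ... | no ¬smaller = S , PS , λ S′ PS′ → ≮⇒≥ λ lt → ¬smaller (S′ , PS′ , lt)
  go zero S PS ∣S∣≤k | yes (S′ , PS′ , lt) = contradiction (≤-trans lt ∣S∣≤k) λ ()
  go (suc k) S PS ∣S∣≤k | yes (S′ , PS′ , lt) = go k S′ PS′ (s≤s⁻¹ (≤-trans lt ∣S∣≤k))

-- Hitting sets, costs and extraction

Meets : Subset n → Subset n → Set
Meets S Z = ∃ λ v → v ∈ S × v ∈ Z

meets? : ∀ (S Z : Subset n) → Dec (Meets S Z)
meets? S Z = Fin.any? λ v → (v ∈? S) ×-dec (v ∈? Z)

T-clique? : ∀ (G : Graph n) t → Decidable (TClique G t)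
T-clique? G t K = Fin.all? (λ u → Fin.all? λ v →
  (u ∈? K) →-dec (v ∈? K) →-dec (¬? (u Fin.≟ v)) →-dec T? (Graph.adj G u v)) ×-dec (∣ K ∣ ≟ t)

TClique-nonempty : ∀ (G : Graph n) {t K} → 0 < t → TClique G t K → Nonempty K
TClique-nonempty G 0<t (_ , ∣K∣≡t) = 0<∣p∣⇒Nonempty _ (subst (0 <_) (≡.sym ∣K∣≡t) 0<t)

module Hitting {n} (G : Graph n) (t : ℕ) (0<t : 0 < t)
  (H : Subset n → Set) (H? : Decidable H)
  (H-clique : ∀ {Z} → H Z → IsClique G Z) (H-size : ∀ {Z} → H Z → ∣ Z ∣ ≤ t)
  (TClique⇒H : ∀ {K} → TClique G t K → H K) where

  private variable
    U U′ A S Z : Subset n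
    L L′ : List (Subset n)
    m m′ : ℕ

  HitsCliques : Subset n → Subset n → Set
  HitsCliques U S = ∀ K → K ⊆ U → TClique G t K → Meets S K

  hitsCliques? : ∀ U → Decidable (HitsCliques U)
  hitsCliques? U S = allSubsets? λ K → (K ⊆? U) →-dec T-clique? G t K →-dec meets? S K

  hitsCliques-mono : U′ ⊆ U → HitsCliques U S → HitsCliques U′ S
  hitsCliques-mono U′⊆U hits K K⊆U′ = hits K (⊆-trans K⊆U′ U′⊆U)

  hitsCliques-∩ : U′ ⊆ U → HitsCliques U S → HitsCliques U′ (S ∩ U′)
  hitsCliques-∩ U′⊆U hits K K⊆U′ c with hits K (⊆-trans K⊆U′ U′⊆U) c
  ... | v , v∈S , v∈K = v , x∈p∩q⁺ (v∈S , K⊆U′ v∈K) , v∈K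

  abstract
    private
      optimum : ∀ U → ∃ λ S → HitsCliques U S × (∀ S′ → HitsCliques U S′ → ∣ S ∣ ≤ ∣ S′ ∣)
      optimum U = smallest (hitsCliques? U) (U , λ K K⊆U c → case TClique-nonempty G 0<t c of
        λ (v , v∈K) → v , K⊆U v∈K , v∈K)

    opt : Subset n → ℕ
    opt U = ∣ proj₁ (optimum U) ∣

    opt-least : HitsCliques U S → opt U ≤ ∣ S ∣
    opt-least = proj₂ (proj₂ (optimum _)) _

    optimal : ∀ U → ∃ λ S → S ⊆ U × HitsCliques U S × ∣ S ∣ ≤ opt U
    optimal U = let S , hits , _ = optimum U in
      S ∩ U , p∩q⊆q S U , hitsCliques-∩ ⊆-refl hits , ∣p∩q∣≤∣p∣ S U

  opt-mono : (∀ {S} → HitsCliques U′ S → HitsCliques U S) → opt U ≤ opt U′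
  opt-mono {U′} f = let S , _ , hits , ∣S∣≤ = optimal U′ in ≤-trans (opt-least (f hits)) ∣S∣≤

  -- A is the part of the solution already chosen outside U.
  SolutionOf : (Subset n → Set) → Subset n → Subset n → Subset n → Set
  SolutionOf P U A S = S ⊆ U × HitsCliques U S × (∀ Z → P Z → Meets (A ∪ S) Z)

  Solution : Subset n → Subset n → Subset n → Set
  Solution = SolutionOf H

  SolutionL : List (Subset n) → Subset n → Subset n → Subset n → Set
  SolutionL L = SolutionOf (_∈ˡ L)

  -- A lower bound rather than a minimum, because a solution need not exist: the cost is then
  -- infinite.
  Cost≥ : Subset n → Subset n → ℕ → Set
  Cost≥ U A q = ∀ S → Solution U A S → q ≤ ∣ S ∣

  abstract
    solution? : ∀ U A → Decidable (Solution U A)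
    solution? U A S = (S ⊆? U) ×-dec hitsCliques? U S ×-dec
      allSubsets? λ Z → H? Z →-dec meets? (A ∪ S) Z

    cost≥? : ∀ U A q → Dec (Cost≥ U A q)
    cost≥? U A q = allSubsets? λ S → solution? U A S →-dec (q ≤? ∣ S ∣)

  cost≱⇒solution : ∀ {q} → ¬ Cost≥ U A q → ∃ λ S → Solution U A S × ∣ S ∣ < q
  cost≱⇒solution {U} {A} {q} ¬cost with ¬∀⟶∃¬-Subset (λ S → solution? U A S →-dec (q ≤? ∣ S ∣)) ¬cost
  ... | S , ¬imp = S , sol , ≰⇒> λ q≤ → ¬imp (λ _ → q≤)
    where sol = decidable-stable (solution? U A S) λ ¬sol → ¬imp (λ sol → contradiction sol ¬sol)

  CostL≥ : List (Subset n) → Subset n → Subset n → ℕ → Set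
  CostL≥ L U A q = ∀ S → SolutionL L U A S → q ≤ ∣ S ∣

  weaken : (∀ {Z} → Z ∈ˡ L → Z ∈ˡ L′) → SolutionL L′ U A S → SolutionL L U A S
  weaken L⊆L′ (S⊆U , hits , sol) = S⊆U , hits , λ Z Z∈L → sol Z (L⊆L′ Z∈L)

  Extract : ℕ → (List (Subset n) → Set) → Set
  Extract m P = ∃ λ L → (∀ {Z} → Z ∈ˡ L → H Z) × length L ≤ m × P L

  Monotone : (List (Subset n) → Set) → Set
  Monotone P = ∀ {L L′} → (∀ {Z} → Z ∈ˡ L → Z ∈ˡ L′) → P L → P L′

  extract-map : ∀ {P Q} → m ≤ m′ → (∀ {L} → P L → Q L) → Extract m P → Extract m′ Q
  extract-map m≤m′ f (L , L⊆H , ∣L∣≤m , PL) = L , L⊆H , ≤-trans ∣L∣≤m m≤m′ , f PL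

  extract-× : ∀ {P Q} → Monotone P → Monotone Q → Extract m P → Extract m′ Q →
              Extract (m + m′) (λ L → P L × Q L)
  extract-× monoP monoQ (L , L⊆H , ∣L∣≤m , PL) (L′ , L′⊆H , ∣L′∣≤m′ , QL′) =
    L ++ L′ , [ L⊆H , L′⊆H ]′ ∘ ∈-++⁻ L ,
    ≤-trans (≤-reflexive (length-++ L)) (+-mono-≤ ∣L∣≤m ∣L′∣≤m′) ,
    monoP ∈-++⁺ˡ PL , monoQ (∈-++⁺ʳ L) QL′

  extract-∀∈ : ∀ {P : Subset n → List (Subset n) → Set} → (∀ Z → Monotone (P Z)) →
               ∀ L₀ → (∀ Z → Z ∈ˡ L₀ → Extract m (P Z)) →
               Extract (length L₀ * m) (λ L → ∀ Z → Z ∈ˡ L₀ → P Z L)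
  extract-∀∈ mono [] f = [] , (λ ()) , z≤n , λ _ ()
  extract-∀∈ mono (Z ∷ L₀) f =
    extract-map ≤-refl (λ { (PZ , P) _ (here refl) → PZ ; (PZ , P) Z (there Z∈) → P Z Z∈ })
      (extract-× (mono Z) (λ sub P Z Z∈ → mono Z sub (P Z Z∈))
        (f Z (here refl)) (extract-∀∈ mono L₀ λ Z Z∈ → f Z (there Z∈)))

  extract-∀∈Subset : ∀ {n} {P : Fin n → List (Subset _) → Set} → (∀ v → Monotone (P v)) →
                     ∀ Z → (∀ v → v ∈ Z → Extract m (P v)) →
                     Extract (∣ Z ∣ * m) (λ L → ∀ v → v ∈ Z → P v L)
  extract-∀∈Subset mono [] f = [] , (λ ()) , z≤n , λ _ ()
  extract-∀∈Subset mono (outside ∷ Z) f =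
    extract-map ≤-refl (λ { P (suc v) (there v∈) → P v v∈ })
      (extract-∀∈Subset (mono ∘ suc) Z λ v v∈ → f (suc v) (there v∈))
  extract-∀∈Subset mono (inside ∷ Z) f =
    extract-map ≤-refl (λ { (P0 , P) zero here → P0 ; (P0 , P) (suc v) (there v∈) → P v v∈ })
      (extract-× (mono zero) (λ sub P v v∈ → mono (suc v) sub (P v v∈))
        (f zero here) (extract-∀∈Subset (mono ∘ suc) Z λ v v∈ → f (suc v) (there v∈)))

  Disjoint : Subset n → Subset n → Set
  Disjoint A U = ∀ {v} → v ∈ A → v ∉ U

  -- The induction hypothesis. The number `f j` is uniform in `A`, so a branch may move chosen
  -- vertices into `A` and recurse.
  Bounded : (ℕ → ℕ) → Subset n → Set
  Bounded f U = ∀ j A q → Disjoint A U → q ≤ opt U + j → Cost≥ U A q →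
                Extract (f j) (λ L → CostL≥ L U A q)

  costL-mono : ∀ {q} → Monotone (λ L → CostL≥ L U A q)
  costL-mono sub cost S sol = cost S (weaken sub sol)

  extract-trivial : ∀ {q} → q ≤ opt U → Extract m (λ L → CostL≥ L U A q)
  extract-trivial q≤opt = [] , (λ ()) , z≤n , λ S (_ , hits , _) → ≤-trans q≤opt (opt-least hits)

  -- With nothing left to choose, one set missed by `A` rules out every solution. If none is missed,
  -- the empty set is a solution and `q` is 0.
  bounded-empty : ∀ {f} → (∀ j → 0 < f (suc j)) → Empty U → Bounded f U
  bounded-empty f>0 ∄U zero A q dis q≤ cost = extract-trivial (≤-trans q≤ (≤-reflexive (+-identityʳ _)))
  bounded-empty {U} f>0 ∄U (suc j) A q dis q≤ cost
    with allSubsets? (λ Z → H? Z →-dec meets? (A ∪ ⊥) Z)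
  ... | yes all = [] , (λ ()) , z≤n , λ S _ →
    ≤-trans (cost ⊥ ((λ v∈ → contradiction v∈ ∉⊥) , noCliques , all)) (≤-trans (≤-reflexive (∣⊥∣≡0 n)) z≤n)
    where
    noCliques : HitsCliques U ⊥
    noCliques K K⊆U c with TClique-nonempty G 0<t c
    ... | v , v∈K = contradiction (v , K⊆U v∈K) ∄U
  ... | no ¬all with ¬∀⟶∃¬-Subset (λ Z → H? Z →-dec meets? (A ∪ ⊥) Z) ¬all
  ...   | Z , ¬imp = Z ∷ [] , (λ { (here refl) → HZ }) , f>0 j , λ S (S⊆U , _ , sol) →
    case sol Z (here refl) of λ (v , v∈ , v∈Z) → case ∈∪⁻ v∈ of λ where
      (inj₁ v∈A) → contradiction (λ _ → v , ∈∪ˡ v∈A , v∈Z) ¬imp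
      (inj₂ v∈S) → contradiction (v , S⊆U v∈S) ∄U
    where HZ = decidable-stable (H? Z) λ ¬HZ → ¬imp (λ HZ → contradiction HZ ¬HZ)

  x∉p-x : ∀ {x} → x ∉ p - x
  x∉p-x {x = x} x∈ = proj₂ (∈─⁻ x∈) (x∈⁅x⁆ x)

  ∈-⁻ : ∀ {x} → v ∈ p - x → v ∈ p × v ≢ x
  ∈-⁻ v∈ = proj₁ (∈─⁻ v∈) , λ { refl → x∉p-x v∈ }

  Disjoint-⊆ : U′ ⊆ U → Disjoint A U → Disjoint A U′
  Disjoint-⊆ U′⊆U dis v∈A v∈U′ = dis v∈A (U′⊆U v∈U′)

  -- Vertices in no t-clique

  -- The product counts `f (suc j)` sets `L₀` for `U′`, plus `g j` sets for each of the at most `t`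
  -- vertices of each member of `L₀`.
  bounded-extend : ∀ {f g} → (∀ j → f (suc j) * suc (t * g j) ≤ g (suc j)) →
    U′ ⊆ U → (∀ {S} → HitsCliques U′ S → HitsCliques U S) → Bounded f U′ → Bounded g U
  bounded-extend {U′ = U′} {f = f} {g} f≤g U′⊆U lift bounded j A q = go j A q U′⊆U lift
    where
    -- `U` loses the vertices branched on while `U′` stays fixed, so the recursion is on `j` alone.
    go : ∀ {U} j A q → U′ ⊆ U → (∀ {S} → HitsCliques U′ S → HitsCliques U S) →
         Disjoint A U → q ≤ opt U + j → Cost≥ U A q → Extract (g j) (λ L → CostL≥ L U A q)
    go zero A q U′⊆U lift dis q≤ cost = extract-trivial (≤-trans q≤ (≤-reflexive (+-identityʳ _)))
    go (suc j) A zero U′⊆U lift dis q≤ cost = extract-trivial z≤n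
    go {U} (suc j) A (suc q) U′⊆U lift dis q≤ cost =
      finish (bounded (suc j) A (suc q) (Disjoint-⊆ U′⊆U dis)
        (≤-trans q≤ (+-monoˡ-≤ (suc j) (opt-mono lift)))
        (λ S (S⊆U′ , hits , sol) → cost S (⊆-trans S⊆U′ U′⊆U , lift hits , sol)))
      where
      Branch : Fin n → List (Subset n) → Set
      Branch w L = w ∈ U → w ∉ U′ → CostL≥ L (U - w) (A ∪ ⁅ w ⁆) q

      branch-mono : ∀ w → Monotone (Branch w)
      branch-mono w sub b w∈U w∉U′ = costL-mono sub (b w∈U w∉U′)

      branch : ∀ w → Extract (g j) (Branch w)
      branch w with w ∈? U | w ∈? U′
      ... | no w∉U | _ = [] , (λ ()) , z≤n , λ w∈U → contradiction w∈U w∉U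
      ... | yes _ | yes w∈U′ = [] , (λ ()) , z≤n , λ _ w∉U′ → contradiction w∈U′ w∉U′
      ... | yes w∈U | no w∉U′ = extract-map ≤-refl (λ c _ _ → c)
        (go j (A ∪ ⁅ w ⁆) q U′⊆U-w (hitsCliques-mono (p─q⊆p U ⁅ w ⁆) ∘ lift) dis′ q≤′ cost′)
        where
        U′⊆U-w : U′ ⊆ U - w
        U′⊆U-w v∈U′ = x∈p∧x≢y⇒x∈p-y (U′⊆U v∈U′) λ { refl → w∉U′ v∈U′ }

        dis′ : Disjoint (A ∪ ⁅ w ⁆) (U - w)
        dis′ v∈ v∈U-w = case ∈∪⁻ v∈ of λ where
          (inj₁ v∈A) → dis v∈A (proj₁ (∈-⁻ v∈U-w))
          (inj₂ v∈w) → proj₂ (∈-⁻ v∈U-w) (x∈⁅y⁆⇒x≡y w v∈w)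

        -- Removing `w` does not lower `opt`, as `U′` still accounts for all t-cliques; the unit
        -- spent on `w` comes out of the excess.
        q≤′ : q ≤ opt (U - w) + j
        q≤′ = s≤s⁻¹ (≤-trans q≤ (≤-trans (≤-reflexive (+-suc (opt U) j))
          (s≤s (+-monoˡ-≤ j (opt-mono (lift ∘ hitsCliques-mono U′⊆U-w))))))

        cost′ : Cost≥ (U - w) (A ∪ ⁅ w ⁆) q
        cost′ S (S⊆ , hits , sol) = s≤s⁻¹ (≤-trans (cost (S ∪ ⁅ w ⁆) (S+w⊆U , lift hits′ , sol′))
                                                   (∣p∪⁅x⁆∣≤1+∣p∣ S w))
          where
          S+w⊆U : S ∪ ⁅ w ⁆ ⊆ U
          S+w⊆U v∈ = case ∈∪⁻ v∈ of λ where
            (inj₁ v∈S) → p─q⊆p U ⁅ w ⁆ (S⊆ v∈S)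
            (inj₂ v∈w) → subst (_∈ U) (≡.sym (x∈⁅y⁆⇒x≡y w v∈w)) w∈U

          hits′ : HitsCliques U′ (S ∪ ⁅ w ⁆)
          hits′ K K⊆U′ c = case hits K (⊆-trans K⊆U′ U′⊆U-w) c of λ (v , v∈S , v∈K) → v , ∈∪ˡ v∈S , v∈K

          sol′ : ∀ Z → H Z → Meets (A ∪ (S ∪ ⁅ w ⁆)) Z
          sol′ Z HZ with sol Z HZ
          ... | v , v∈ , v∈Z with ∈∪⁻ v∈
          ...   | inj₂ v∈S = v , ∈∪ʳ (∈∪ˡ v∈S) , v∈Z
          ...   | inj₁ v∈A+w with ∈∪⁻ v∈A+w
          ...     | inj₁ v∈A = v , ∈∪ˡ v∈A , v∈Z
          ...     | inj₂ v∈w = v , ∈∪ʳ (∈∪ʳ v∈w) , v∈Z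

      finish : Extract (f (suc j)) (λ L → CostL≥ L U′ A (suc q)) →
               Extract (g (suc j)) (λ L → CostL≥ L U A (suc q))
      finish (L₀ , L₀⊆H , ∣L₀∣≤ , cost₀) = extract-map bound combine
        (extract-× (λ sub L₀⊆L Z → sub ∘ L₀⊆L Z) (λ sub b Z Z∈ w w∈Z → branch-mono w sub (b Z Z∈ w w∈Z))
          (L₀ , L₀⊆H , ∣L₀∣≤ , λ _ → id)
          (extract-∀∈ (λ Z sub b w w∈Z → branch-mono w sub (b w w∈Z)) L₀ λ Z Z∈ →
            extract-map (*-monoˡ-≤ (g j) (H-size (L₀⊆H Z∈))) id
              (extract-∀∈Subset branch-mono Z λ w _ → branch w)))
        where
        bound : f (suc j) + length L₀ * (t * g j) ≤ g (suc j)
        bound = ≤-trans (+-monoʳ-≤ (f (suc j)) (*-monoˡ-≤ (t * g j) ∣L₀∣≤))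
                (≤-trans (≤-reflexive (≡.sym (*-suc (f (suc j)) (t * g j)))) (f≤g j))

        combine : ∀ {L} → (∀ Z → Z ∈ˡ L₀ → Z ∈ˡ L) ×
                  (∀ Z → Z ∈ˡ L₀ → ∀ w → w ∈ Z → Branch w L) → CostL≥ L U A (suc q)
        combine {L} (L₀⊆L , branches) S (S⊆U , hits , sol)
          with All.all? (λ Z → meets? (A ∪ (S ∩ U′)) Z) L₀
        -- If `S ∩ U′` settles `L₀`, the bound on `U′` applies. Otherwise a missed `Z` is hit at
        -- some `w` outside `U′`, and the branch of `w` bounds `S - w`.
        ... | yes all = ≤-trans
          (cost₀ (S ∩ U′) (p∩q⊆q S U′ , hitsCliques-∩ U′⊆U hits , λ Z → All.lookup all))
          (∣p∩q∣≤∣p∣ S U′)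
        ... | no ¬all with find (All.¬All⇒Any¬ (λ Z → meets? (A ∪ (S ∩ U′)) Z) L₀ ¬all)
        ...   | Z , Z∈L₀ , ¬meets with sol Z (L₀⊆L Z Z∈L₀)
        ...     | w , w∈ , w∈Z with ∈∪⁻ w∈
        ...       | inj₁ w∈A = contradiction (w , ∈∪ˡ w∈A , w∈Z) ¬meets
        ...       | inj₂ w∈S = ≤-trans
          (s≤s (branches Z Z∈L₀ w w∈Z (S⊆U w∈S) w∉U′ (S - w) (S-w⊆U-w , hits′ , sol′)))
          (x∈p⇒∣p-x∣<∣p∣ w∈S)
          where
          w∉U′ : w ∉ U′
          w∉U′ w∈U′ = ¬meets (w , ∈∪ʳ (x∈p∩q⁺ (w∈S , w∈U′)) , w∈Z)

          S-w⊆U-w : S - w ⊆ U - w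
          S-w⊆U-w v∈ = let v∈S , v≢w = ∈-⁻ v∈ in x∈p∧x≢y⇒x∈p-y (S⊆U v∈S) v≢w

          hits′ : HitsCliques (U - w) (S - w)
          hits′ K K⊆U-w c = case hits K (⊆-trans K⊆U-w (p─q⊆p U ⁅ w ⁆)) c of λ (v , v∈S , v∈K) →
            v , x∈p∧x≢y⇒x∈p-y v∈S (proj₂ (∈-⁻ (K⊆U-w v∈K))) , v∈K

          sol′ : ∀ Z → Z ∈ˡ L → Meets ((A ∪ ⁅ w ⁆) ∪ (S - w)) Z
          sol′ Z Z∈L with sol Z Z∈L
          ... | v , v∈ , v∈Z with ∈∪⁻ v∈ | v Fin.≟ w
          ...   | inj₁ v∈A | _ = v , ∈∪ˡ (∈∪ˡ v∈A) , v∈Z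
          ...   | inj₂ v∈S | yes refl = v , ∈∪ˡ (∈∪ʳ (x∈⁅x⁆ w)) , v∈Z
          ...   | inj₂ v∈S | no v≢w = v , ∈∪ʳ (x∈p∧x≢y⇒x∈p-y v∈S v≢w) , v∈Z

  -- Dividing a cost between two sides

  -- The sides are chosen independently, so least costs add up. `i₁` is raised until some solution
  -- on `D₁` prevents the next step; paired with any solution on `D₂`, it pushes the remainder onto
  -- `D₂`. Stopping at `j` covers infinite costs.
  split-cost : ∀ {D₁ D₂ A₁ A₂ q₁ q₂} j → Cost≥ D₁ A₁ q₁ → Cost≥ D₂ A₂ q₂ →
    (∀ S₁ S₂ → Solution D₁ A₁ S₁ → Solution D₂ A₂ S₂ → q₁ + q₂ + j ≤ ∣ S₁ ∣ + ∣ S₂ ∣) →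
    ∃₂ λ i₁ i₂ → i₁ + i₂ ≡ j × Cost≥ D₁ A₁ (q₁ + i₁) × Cost≥ D₂ A₂ (q₂ + i₂)
  split-cost {D₁} {D₂} {A₁} {A₂} {q₁} {q₂} j cost₁ cost₂ cost =
    go 0 j refl (subst (Cost≥ D₁ A₁) (≡.sym (+-identityʳ q₁)) cost₁)
    where
    go : ∀ i₁ i₂ → i₁ + i₂ ≡ j → Cost≥ D₁ A₁ (q₁ + i₁) →
         ∃₂ λ i₁ i₂ → i₁ + i₂ ≡ j × Cost≥ D₁ A₁ (q₁ + i₁) × Cost≥ D₂ A₂ (q₂ + i₂)
    go i₁ zero i₁+i₂≡j c₁ = i₁ , 0 , i₁+i₂≡j , c₁ , subst (Cost≥ D₂ A₂) (≡.sym (+-identityʳ q₂)) cost₂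
    go i₁ (suc i₂) i₁+i₂≡j c₁ with cost≥? D₁ A₁ (q₁ + suc i₁)
    ... | yes c₁′ = go (suc i₁) i₂ (trans (≡.sym (+-suc i₁ i₂)) i₁+i₂≡j) c₁′
    ... | no ¬c₁′ = i₁ , suc i₂ , i₁+i₂≡j , c₁ , λ S₂ sol₂ →
      let S₁ , sol₁ , ∣S₁∣< = cost≱⇒solution ¬c₁′
          ∣S₁∣≤ = s≤s⁻¹ (≤-trans ∣S₁∣< (≤-reflexive (+-suc q₁ i₁)))
      in +-cancelˡ-≤ (q₁ + i₁) _ _ (begin
           (q₁ + i₁) + (q₂ + suc i₂) ≡⟨ interchange +-commutativeSemigroup q₁ i₁ q₂ (suc i₂) ⟩
           (q₁ + q₂) + (i₁ + suc i₂) ≡⟨ cong (q₁ + q₂ +_) i₁+i₂≡j ⟩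
           (q₁ + q₂) + j             ≤⟨ cost S₁ S₂ sol₁ sol₂ ⟩
           ∣ S₁ ∣ + ∣ S₂ ∣           ≤⟨ +-monoˡ-≤ ∣ S₂ ∣ ∣S₁∣≤ ⟩
           (q₁ + i₁) + ∣ S₂ ∣        ∎)
      where open ≤-Reasoning

  extract-split : ∀ {D₁ D₂ A₁ A₂ q₁ q₂ j} → Cost≥ D₁ A₁ q₁ → Cost≥ D₂ A₂ q₂ →
    (∀ S₁ S₂ → Solution D₁ A₁ S₁ → Solution D₂ A₂ S₂ → q₁ + q₂ + j ≤ ∣ S₁ ∣ + ∣ S₂ ∣) →
    (∀ i → i ≤ j → Cost≥ D₁ A₁ (q₁ + i) → Extract m (λ L → CostL≥ L D₁ A₁ (q₁ + i))) →
    (∀ i → i ≤ j → Cost≥ D₂ A₂ (q₂ + i) → Extract m′ (λ L → CostL≥ L D₂ A₂ (q₂ + i))) →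
    Extract (m + m′) (λ L → ∀ S₁ S₂ → SolutionL L D₁ A₁ S₁ → SolutionL L D₂ A₂ S₂ →
                            q₁ + q₂ + j ≤ ∣ S₁ ∣ + ∣ S₂ ∣)
  extract-split {D₁ = D₁} {D₂} {A₁} {A₂} {q₁} {q₂} {j} cost₁ cost₂ cost ext₁ ext₂
    with split-cost {D₁} {D₂} {A₁} {A₂} {q₁} {q₂} j cost₁ cost₂ cost
  ... | i₁ , i₂ , refl , c₁ , c₂ =
    extract-map ≤-refl
      (λ (b₁ , b₂) S₁ S₂ sol₁ sol₂ → ≤-trans
        (≤-reflexive (interchange +-commutativeSemigroup q₁ q₂ i₁ i₂))
        (+-mono-≤ (b₁ S₁ sol₁) (b₂ S₂ sol₂)))
      (extract-× costL-mono costL-mono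
        (ext₁ i₁ (m≤m+n i₁ i₂) c₁) (ext₂ i₂ (m≤n+m i₂ i₁) c₂))

  Separates : Subset n → Subset n → Set
  Separates D U = ∀ K → K ⊆ U → TClique G t K → K ⊆ D ⊎ K ⊆ U ─ D

  module _ {D U} (D⊆U : D ⊆ U) (sep : Separates D U) where

    private
      combine : ∀ {S₁ S₂} → HitsCliques D S₁ → HitsCliques (U ─ D) S₂ → HitsCliques U (S₁ ∪ S₂)
      combine hits₁ hits₂ K K⊆U c with sep K K⊆U c
      ... | inj₁ K⊆D = case hits₁ K K⊆D c of λ (v , v∈S , v∈K) → v , ∈∪ˡ v∈S , v∈K
      ... | inj₂ K⊆U─D = case hits₂ K K⊆U─D c of λ (v , v∈S , v∈K) → v , ∈∪ʳ v∈S , v∈K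

    hitsCliques-─ : HitsCliques U S → HitsCliques (U ─ D) (S ─ D)
    hitsCliques-─ hits K K⊆ c = case hits K (⊆-trans K⊆ (p─q⊆p U D)) c of λ (v , v∈S , v∈K) →
      v , x∈p∧x∉q⇒x∈p─q v∈S (proj₂ (∈─⁻ (K⊆ v∈K))) , v∈K

    opt-split : opt D + opt (U ─ D) ≡ opt U
    opt-split = ≤-antisym
      (let S , _ , hits , ∣S∣≤ = optimal U in begin
        opt D + opt (U ─ D)     ≤⟨ +-mono-≤ (opt-least (hitsCliques-∩ D⊆U hits)) (opt-least (hitsCliques-─ hits)) ⟩
        ∣ S ∩ D ∣ + ∣ S ─ D ∣   ≡⟨ ∣p∩q∣+∣p─q∣≡∣p∣ S D ⟩
        ∣ S ∣                   ≤⟨ ∣S∣≤ ⟩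
        opt U                   ∎)
      (let S₁ , _ , hits₁ , ∣S₁∣≤ = optimal D
           S₂ , _ , hits₂ , ∣S₂∣≤ = optimal (U ─ D) in begin
        opt U                 ≤⟨ opt-least (combine hits₁ hits₂) ⟩
        ∣ S₁ ∪ S₂ ∣           ≤⟨ ∣p∪q∣≤∣p∣+∣q∣ S₁ S₂ ⟩
        ∣ S₁ ∣ + ∣ S₂ ∣       ≤⟨ +-mono-≤ ∣S₁∣≤ ∣S₂∣≤ ⟩
        opt D + opt (U ─ D)   ∎)
      where open ≤-Reasoning

    -- Exchange step: whatever `S` does inside `D`, it pays at least `opt D` there.
    replace : ∀ {S T} → HitsCliques U S → HitsCliques D T → ∣ T ∣ ≤ opt D →
              HitsCliques U ((S ─ D) ∪ T) × ∣ (S ─ D) ∪ T ∣ ≤ ∣ S ∣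
    replace {S} {T} hitsS hitsT ∣T∣≤ = hits , (begin
      ∣ (S ─ D) ∪ T ∣         ≤⟨ ∣p∪q∣≤∣p∣+∣q∣ (S ─ D) T ⟩
      ∣ S ─ D ∣ + ∣ T ∣       ≤⟨ +-monoʳ-≤ ∣ S ─ D ∣ (≤-trans ∣T∣≤ (opt-least (hitsCliques-∩ D⊆U hitsS))) ⟩
      ∣ S ─ D ∣ + ∣ S ∩ D ∣   ≡⟨ +-comm ∣ S ─ D ∣ _ ⟩
      ∣ S ∩ D ∣ + ∣ S ─ D ∣   ≡⟨ ∣p∩q∣+∣p─q∣≡∣p∣ S D ⟩
      ∣ S ∣                   ∎)
      where
      open ≤-Reasoning
      hits : HitsCliques U ((S ─ D) ∪ T)
      hits K K⊆U c = case combine hitsT (hitsCliques-─ hitsS) K K⊆U c of λ (v , v∈ , v∈K) →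
        v , [ ∈∪ʳ , ∈∪ˡ ]′ (∈∪⁻ v∈) , v∈K

  -- Roots

  inPart? : ∀ (home : Fin n → Maybe (Fin n)) U h → Decidable (λ v → v ∈ U × home v ≡ h)
  inPart? home U h v = (v ∈? U) ×-dec ≡-dec Fin._≟_ (home v) h

  Part : (Fin n → Maybe (Fin n)) → Subset n → Maybe (Fin n) → Subset n
  Part home U h = comprehension (inPart? home U h)

  -- `home` names the root vertex at which a vertex hangs, with `nothing` for unattached components.
  -- Unlike the root condition itself, these axioms survive the removal of a whole part with `home`
  -- unchanged, which the recursion into the other parts requires.
  record Rooted (home : Fin n → Maybe (Fin n)) (X U : Subset n) : Set where
    field
      X⊆U      : X ⊆ U
      X-free   : KtFree G t X
      home-own : ∀ {x} → x ∈ X → home x ≡ just x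
      home-X   : ∀ {v x} → v ∈ U → home v ≡ just x → x ∈ X
      home-adj : ∀ {u v} → u ∈ U → v ∈ U → Edge G u v → home u ≡ home v ⊎ (u ∈ X × v ∈ X)

  module _ {home} {X U} (rooted : Rooted home X U) where

    open Rooted rooted

    P : Maybe (Fin n) → Subset n
    P = Part home U

    ∈P⁺ : ∀ {h} → v ∈ U → home v ≡ h → v ∈ P h
    ∈P⁺ v∈U eq = ∈-comprehension⁺ (inPart? home U _) (v∈U , eq)

    ∈P⁻ : ∀ {h} → v ∈ P h → v ∈ U × home v ≡ h
    ∈P⁻ = ∈-comprehension⁻ (inPart? home U _)

    P⊆U : ∀ {h} → P h ⊆ U
    P⊆U = proj₁ ∘ ∈P⁻

    P∩X : ∀ {x} → v ∈ P (just x) → v ∈ X → v ≡ x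
    P∩X v∈P v∈X = just-injective (trans (≡.sym (home-own v∈X)) (proj₂ (∈P⁻ v∈P)))

    ∈P-self : ∀ {x} → x ∈ X → x ∈ P (just x)
    ∈P-self x∈X = ∈P⁺ (X⊆U x∈X) (home-own x∈X)

    P-nothing∌X : v ∈ P nothing → v ∉ X
    P-nothing∌X v∈P v∈X = case trans (≡.sym (home-own v∈X)) (proj₂ (∈P⁻ v∈P)) of λ ()

    -- Edges between different parts join two vertices of `X`, so a vertex off `X` keeps its
    -- neighbours in its own part.
    clique⊆P : ∀ {h} → IsClique G Z → v ∈ Z → v ∈ P h → v ∉ X →
               ∀ {u} → u ∈ Z → u ∈ U → u ∈ P h
    clique⊆P {v = v} clique v∈Z v∈P v∉X {u} u∈Z u∈U with u Fin.≟ v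
    ... | yes refl = v∈P
    ... | no u≢v with home-adj u∈U (P⊆U v∈P) (clique _ _ u∈Z v∈Z u≢v)
    ...   | inj₁ eq = ∈P⁺ u∈U (trans eq (proj₂ (∈P⁻ v∈P)))
    ...   | inj₂ (_ , v∈X) = contradiction v∈X v∉X

    -- As `X` is K_t-free, a t-clique has a vertex off `X`, and the part of that vertex contains it.
    P-separates : ∀ h → Separates (P h) U
    P-separates h K K⊆U c with Fin.all? (λ v → (v ∈? K) →-dec (v ∈? X))
    ... | yes K⊆X = contradiction c (X-free K λ {v} → K⊆X v)
    ... | no K⊈X with Fin.¬∀⟶∃¬ n _ (λ v → (v ∈? K) →-dec (v ∈? X)) K⊈X
    ...   | v , v∈K⇏v∈X = byHome (≡-dec Fin._≟_ (home v) h)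
      where
      v∈K : v ∈ K
      v∈K = decidable-stable (v ∈? K) λ v∉K → v∈K⇏v∈X (λ v∈K → contradiction v∈K v∉K)

      K⊆P : K ⊆ P (home v)
      K⊆P u∈K = clique⊆P (proj₁ c) v∈K (∈P⁺ (K⊆U v∈K) refl) (λ v∈X → v∈K⇏v∈X λ _ → v∈X) u∈K (K⊆U u∈K)

      byHome : Dec (home v ≡ h) → K ⊆ P h ⊎ K ⊆ U ─ P h
      byHome (yes refl) = inj₁ K⊆P
      byHome (no ≢h) = inj₂ λ u∈K → x∈p∧x∉q⇒x∈p─q (K⊆U u∈K)
        λ u∈P → ≢h (trans (≡.sym (proj₂ (∈P⁻ (K⊆P u∈K)))) (proj₂ (∈P⁻ u∈P)))

    restrict : ∀ h → Rooted home (X ─ P h) (U ─ P h)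
    restrict h = record
      { X⊆U = λ v∈ → let v∈X , v∉P = ∈─⁻ v∈ in x∈p∧x∉q⇒x∈p─q (X⊆U v∈X) v∉P
      ; X-free = λ K K⊆ → X-free K (⊆-trans K⊆ (p─q⊆p X (P h)))
      ; home-own = home-own ∘ proj₁ ∘ ∈─⁻
      ; home-X = λ v∈ eq → let v∈U , v∉P = ∈─⁻ v∈ ; x∈X = home-X v∈U eq in
          x∈p∧x∉q⇒x∈p─q x∈X λ x∈P →
            v∉P (∈P⁺ v∈U (trans eq (trans (≡.sym (home-own x∈X)) (proj₂ (∈P⁻ x∈P)))))
      ; home-adj = λ u∈ v∈ e → let u∈U , u∉P = ∈─⁻ u∈ ; v∈U , v∉P = ∈─⁻ v∈ in
          case home-adj u∈U v∈U e of λ where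
            (inj₁ eq) → inj₁ eq
            (inj₂ (u∈X , v∈X)) → inj₂ (x∈p∧x∉q⇒x∈p─q u∈X u∉P , x∈p∧x∉q⇒x∈p─q v∈X v∉P)
      }

    -- Branching at a root vertex

    V V̄ R : Fin n → Subset n
    V x = P (just x)
    V̄ x = U ─ V x
    R x = V x - x

    R⊆V : ∀ {x} → R x ⊆ V x
    R⊆V {x} = p─q⊆p (V x) ⁅ x ⁆

    R∌X : ∀ {x} → v ∈ R x → v ∉ X
    R∌X v∈R v∈X = let v∈V , v≢x = ∈-⁻ v∈R in v≢x (P∩X v∈V v∈X)

    V-cases : ∀ {x} → v ∈ V x → v ≡ x ⊎ v ∈ R x
    V-cases {v} {x} v∈V with v Fin.≟ x
    ... | yes v≡x = inj₁ v≡x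
    ... | no v≢x = inj₂ (x∈p∧x≢y⇒x∈p-y v∈V v≢x)

    hitsCliques-V : ∀ {x T} → HitsCliques (R x) T → x ∈ S → T ⊆ S → HitsCliques (V x) S
    hitsCliques-V {x = x} hits x∈S T⊆S K K⊆V c with x ∈? K
    ... | yes x∈K = x , x∈S , x∈K
    ... | no x∉K = case hits K (λ v∈K → x∈p∧x≢y⇒x∈p-y (K⊆V v∈K) λ { refl → x∉K v∈K }) c of
      λ (v , v∈T , v∈K) → v , T⊆S v∈T , v∈K

    opt-V≤ : ∀ x → opt (V x) ≤ suc (opt (R x))
    opt-V≤ x = let T , _ , hits , ∣T∣≤ = optimal (R x) in
      ≤-trans (opt-least (hitsCliques-V hits (∈∪ʳ (x∈⁅x⁆ x)) ∈∪ˡ))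
              (≤-trans (∣p∪⁅x⁆∣≤1+∣p∣ T x) (s≤s ∣T∣≤))

    -- `e` is the bound one level down, for sets off `X`; `d` is the bound under construction, and
    -- `rest` is its induction hypothesis at the smaller excess.
    module _ (e d : ℕ → ℕ) (j : ℕ)
      (bounded : ∀ {D} → D ⊆ U → (∀ {v} → v ∈ D → v ∉ X) → Bounded e D)
      (rest : ∀ h A q → Disjoint A (U ─ P h) → q ≤ opt (U ─ P h) + j → Cost≥ (U ─ P h) A q →
              Extract (d j) (λ L → CostL≥ L (U ─ P h) A q))
      {A} (dis : Disjoint A U) (cost : Cost≥ U A (opt U + suc j)) where

      Q : ℕ
      Q = opt U + suc j

      -- Both say that `V x` costs more than `opt (V x)` even with the rest of `U` granted: the
      -- first for solutions containing `x`, where `x` is itself the extra unit, the second for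
      -- solutions avoiding it.
      InCostly OutCostly : Fin n → Set
      InCostly x = Cost≥ (R x) (A ∪ (U ─ R x)) (opt (V x))
      OutCostly x = Cost≥ (R x) (A ∪ V̄ x) (suc (opt (V x)))

      dis-∪─ : ∀ {D D′} → D′ ⊆ D → D′ ⊆ U → Disjoint (A ∪ (U ─ D)) D′
      dis-∪─ D′⊆D D′⊆U v∈ v∈D′ = case ∈∪⁻ v∈ of λ where
        (inj₁ v∈A) → dis v∈A (D′⊆U v∈D′)
        (inj₂ v∈) → proj₂ (∈─⁻ v∈) (D′⊆D v∈D′)

      dis-∪ : ∀ {D D′} → D′ ⊆ D → Disjoint (A ∪ D′) (U ─ D)
      dis-∪ D′⊆D v∈ v∈U─D = let v∈U , v∉D = ∈─⁻ v∈U─D in case ∈∪⁻ v∈ of λ where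
        (inj₁ v∈A) → dis v∈A v∈U
        (inj₂ v∈) → v∉D (D′⊆D v∈)

      ∩-solution : ∀ {D D′} → D′ ⊆ D → D′ ⊆ U →
        (∀ {v} → v ∈ S → v ∈ D → v ∈ D′) → SolutionL L U A S → SolutionL L D′ (A ∪ (U ─ D)) (S ∩ D′)
      ∩-solution {S} {D = D} {D′} D′⊆D D′⊆U trace (S⊆U , hits , sol) =
        p∩q⊆q S D′ , hitsCliques-∩ D′⊆U hits , λ Z Z∈L → case sol Z Z∈L of λ (v , v∈ , v∈Z) →
          v , step v∈ , v∈Z
        where
        step : ∀ {v} → v ∈ A ∪ S → v ∈ (A ∪ (U ─ D)) ∪ (S ∩ D′)
        step {v} v∈ with ∈∪⁻ v∈ | v ∈? D
        ... | inj₁ v∈A | _ = ∈∪ˡ (∈∪ˡ v∈A)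
        ... | inj₂ v∈S | yes v∈D = ∈∪ʳ (x∈p∩q⁺ (v∈S , trace v∈S v∈D))
        ... | inj₂ v∈S | no v∉D = ∈∪ˡ (∈∪ʳ (x∈p∧x∉q⇒x∈p─q (S⊆U v∈S) v∉D))

      ─-solution : ∀ {D D′} → D ⊆ U → Separates D U →
        (∀ {v} → v ∈ S → v ∈ D → v ∈ D′) → SolutionL L U A S → SolutionL L (U ─ D) (A ∪ D′) (S ─ D)
      ─-solution {S} {D = D} {D′} D⊆U sep trace (S⊆U , hits , sol) =
        (λ v∈ → let v∈S , v∉D = ∈─⁻ v∈ in x∈p∧x∉q⇒x∈p─q (S⊆U v∈S) v∉D) ,
        hitsCliques-─ D⊆U sep hits , λ Z Z∈L → case sol Z Z∈L of λ (v , v∈ , v∈Z) →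
          v , step v∈ , v∈Z
        where
        step : ∀ {v} → v ∈ A ∪ S → v ∈ (A ∪ D′) ∪ (S ─ D)
        step {v} v∈ with ∈∪⁻ v∈ | v ∈? D
        ... | inj₁ v∈A | _ = ∈∪ˡ (∈∪ˡ v∈A)
        ... | inj₂ v∈S | yes v∈D = ∈∪ˡ (∈∪ʳ (trace v∈S v∈D))
        ... | inj₂ v∈S | no v∉D = ∈∪ʳ (x∈p∧x∉q⇒x∈p─q v∈S v∉D)

      -- Each side was granted vertices that the union may lack, but no set profits from them. A
      -- member of `H` with a vertex of `P h` off `X` has all its vertices of `U` in `P h`, where
      -- the grants to `S₁` lie in `T`. Any other meets `P h` only in `X`, where the grants to `S₂`
      -- lie in `T`.
      merge : ∀ h {D₁ E₁ E₂ T S₁ S₂} → D₁ ⊆ P h → T ⊆ U →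
        (∀ {v} → v ∈ P h → v ∉ E₁ → v ∈ T) → (∀ {v} → v ∈ E₂ → v ∈ P h → v ∈ X → v ∈ T) → E₂ ⊆ P h →
        Solution D₁ (A ∪ (U ─ E₁)) S₁ → Solution (U ─ P h) (A ∪ E₂) S₂ → Solution U A ((S₁ ∪ S₂) ∪ T)
      merge h {D₁} {E₁} {E₂} {T} {S₁} {S₂} D₁⊆P T⊆U P─E₁⊆T E₂∩X⊆T E₂⊆P (S₁⊆ , _ , sol₁) (S₂⊆ , _ , sol₂) =
        S⊆U , hits , sol
        where
        S⊆U : (S₁ ∪ S₂) ∪ T ⊆ U
        S⊆U v∈ with ∈∪⁻ v∈
        ... | inj₂ v∈T = T⊆U v∈T
        ... | inj₁ v∈S₁₂ with ∈∪⁻ v∈S₁₂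
        ...   | inj₁ v∈S₁ = P⊆U (D₁⊆P (S₁⊆ v∈S₁))
        ...   | inj₂ v∈S₂ = p─q⊆p U (P h) (S₂⊆ v∈S₂)

        sol : ∀ Z → H Z → Meets (A ∪ ((S₁ ∪ S₂) ∪ T)) Z
        sol Z HZ with Fin.any? (λ v → (v ∈? Z) ×-dec (v ∈? P h) ×-dec ¬? (v ∈? X))
        sol Z HZ | yes (v , v∈Z , v∈P , v∉X) with sol₁ Z HZ
        ... | u , u∈ , u∈Z with ∈∪⁻ u∈
        ...   | inj₂ u∈S₁ = u , ∈∪ʳ (∈∪ˡ (∈∪ˡ u∈S₁)) , u∈Z
        ...   | inj₁ u∈A₁ with ∈∪⁻ u∈A₁
        ...     | inj₁ u∈A = u , ∈∪ˡ u∈A , u∈Z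
        ...     | inj₂ u∈U─E₁ = let u∈U , u∉E₁ = ∈─⁻ u∈U─E₁ in
          u , ∈∪ʳ (∈∪ʳ (P─E₁⊆T (clique⊆P (H-clique HZ) v∈Z v∈P v∉X u∈Z u∈U) u∉E₁)) , u∈Z
        sol Z HZ | no ¬meets with sol₂ Z HZ
        ... | u , u∈ , u∈Z with ∈∪⁻ u∈
        ...   | inj₂ u∈S₂ = u , ∈∪ʳ (∈∪ˡ (∈∪ʳ u∈S₂)) , u∈Z
        ...   | inj₁ u∈A₂ with ∈∪⁻ u∈A₂
        ...     | inj₁ u∈A = u , ∈∪ˡ u∈A , u∈Z
        ...     | inj₂ u∈E₂ = u , ∈∪ʳ (∈∪ʳ (E₂∩X⊆T u∈E₂ (E₂⊆P u∈E₂)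
          (decidable-stable (u ∈? X) λ u∉X → ¬meets (u , u∈Z , E₂⊆P u∈E₂ , u∉X)))) , u∈Z

        hits : HitsCliques U ((S₁ ∪ S₂) ∪ T)
        hits K K⊆U c = case sol K (TClique⇒H c) of λ (v , v∈ , v∈K) → case ∈∪⁻ v∈ of λ where
          (inj₁ v∈A) → contradiction (K⊆U v∈K) (dis v∈A)
          (inj₂ v∈S) → v , v∈S , v∈K

      -- E₁ is the part of P h that S₁ has to settle alone, E₂ the part that S₂ may take for
      -- granted, and T the vertex of X that is fixed to lie in the solution (if any).
      extract-part : ∀ h {D₁ E₁ E₂ T q₁ m} → D₁ ⊆ P h → D₁ ⊆ E₁ → (∀ {v} → v ∈ D₁ → v ∉ X) → T ⊆ U →
        (∀ {v} → v ∈ P h → v ∉ E₁ → v ∈ T) → (∀ {v} → v ∈ E₂ → v ∈ P h → v ∈ X → v ∈ T) → E₂ ⊆ P h →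
        q₁ + ∣ T ∣ ≡ suc (opt (P h)) → q₁ + j ≤ opt D₁ + m →
        Cost≥ D₁ (A ∪ (U ─ E₁)) q₁ →
        Extract (e m + d j) (λ L → ∀ S → SolutionL L U A S →
          (∀ {v} → v ∈ S → v ∈ E₁ → v ∈ D₁) → (∀ {v} → v ∈ S → v ∈ P h → v ∈ E₂) →
          ∣ S ∩ D₁ ∣ + ∣ T ∣ ≤ ∣ S ∩ P h ∣ → Q ≤ ∣ S ∣)
      extract-part h {D₁} {E₁} {E₂} {T} {q₁} {m} D₁⊆P D₁⊆E₁ D₁∌X T⊆U P─E₁⊆T E₂∩X⊆T E₂⊆P q₁≡ q₁≤ cost₁ =
        extract-map ≤-refl conclude
          (extract-split cost₁ (λ S (_ , hits , _) → opt-least hits)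
            (λ S₁ S₂ sol₁ sol₂ → +-cancelʳ-≤ ∣ T ∣ _ _ (begin
              q₁ + o′ + j + ∣ T ∣           ≡⟨ Q≡ ⟩
              Q                             ≤⟨ cost _ (merge h D₁⊆P T⊆U P─E₁⊆T E₂∩X⊆T E₂⊆P sol₁ sol₂) ⟩
              ∣ (S₁ ∪ S₂) ∪ T ∣             ≤⟨ ∣p∪q∣≤∣p∣+∣q∣ (S₁ ∪ S₂) T ⟩
              ∣ S₁ ∪ S₂ ∣ + ∣ T ∣           ≤⟨ +-monoˡ-≤ ∣ T ∣ (∣p∪q∣≤∣p∣+∣q∣ S₁ S₂) ⟩
              ∣ S₁ ∣ + ∣ S₂ ∣ + ∣ T ∣       ∎))
            (λ i i≤j → bounded (P⊆U ∘ D₁⊆P) D₁∌X m _ _ (dis-∪─ D₁⊆E₁ (P⊆U ∘ D₁⊆P))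
              (≤-trans (+-monoʳ-≤ q₁ i≤j) q₁≤))
            (λ i i≤j → rest h _ _ (dis-∪ E₂⊆P) (+-monoʳ-≤ o′ i≤j)))
        where
        open ≤-Reasoning
        o′ : ℕ
        o′ = opt (U ─ P h)

        Q≡ : q₁ + o′ + j + ∣ T ∣ ≡ Q
        Q≡ = begin-equality
          q₁ + o′ + j + ∣ T ∣        ≡⟨ cong (_+ ∣ T ∣) (+-assoc q₁ o′ j) ⟩
          q₁ + (o′ + j) + ∣ T ∣      ≡⟨ +-assoc q₁ (o′ + j) ∣ T ∣ ⟩
          q₁ + (o′ + j + ∣ T ∣)      ≡⟨ cong (q₁ +_) (+-comm (o′ + j) ∣ T ∣) ⟩
          q₁ + (∣ T ∣ + (o′ + j))    ≡⟨ +-assoc q₁ ∣ T ∣ (o′ + j) ⟨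
          q₁ + ∣ T ∣ + (o′ + j)      ≡⟨ cong (_+ (o′ + j)) q₁≡ ⟩
          suc (opt (P h)) + (o′ + j) ≡⟨ cong suc (+-assoc (opt (P h)) o′ j) ⟨
          suc (opt (P h) + o′ + j)   ≡⟨ cong (λ o → suc (o + j)) (opt-split P⊆U (P-separates h)) ⟩
          suc (opt U + j)            ≡⟨ +-suc (opt U) j ⟨
          Q                          ∎

        conclude : ∀ {L} → (∀ S₁ S₂ → SolutionL L D₁ (A ∪ (U ─ E₁)) S₁ →
            SolutionL L (U ─ P h) (A ∪ E₂) S₂ → q₁ + o′ + j ≤ ∣ S₁ ∣ + ∣ S₂ ∣) →
          ∀ S → SolutionL L U A S →
          (∀ {v} → v ∈ S → v ∈ E₁ → v ∈ D₁) → (∀ {v} → v ∈ S → v ∈ P h → v ∈ E₂) →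
          ∣ S ∩ D₁ ∣ + ∣ T ∣ ≤ ∣ S ∩ P h ∣ → Q ≤ ∣ S ∣
        conclude bound S sol trace₁ trace₂ ∣S∩D₁∣+∣T∣≤ = begin
          Q                                   ≡⟨ Q≡ ⟨
          q₁ + o′ + j + ∣ T ∣                 ≤⟨ +-monoˡ-≤ ∣ T ∣ (bound (S ∩ D₁) (S ─ P h)
                                                   (∩-solution D₁⊆E₁ (P⊆U ∘ D₁⊆P) trace₁ sol)
                                                   (─-solution P⊆U (P-separates h) trace₂ sol)) ⟩
          ∣ S ∩ D₁ ∣ + ∣ S ─ P h ∣ + ∣ T ∣    ≡⟨ +-assoc ∣ S ∩ D₁ ∣ _ _ ⟩
          ∣ S ∩ D₁ ∣ + (∣ S ─ P h ∣ + ∣ T ∣)  ≡⟨ cong (∣ S ∩ D₁ ∣ +_) (+-comm ∣ S ─ P h ∣ _) ⟩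
          ∣ S ∩ D₁ ∣ + (∣ T ∣ + ∣ S ─ P h ∣)  ≡⟨ +-assoc ∣ S ∩ D₁ ∣ _ _ ⟨
          ∣ S ∩ D₁ ∣ + ∣ T ∣ + ∣ S ─ P h ∣    ≤⟨ +-monoˡ-≤ ∣ S ─ P h ∣ ∣S∩D₁∣+∣T∣≤ ⟩
          ∣ S ∩ P h ∣ + ∣ S ─ P h ∣           ≡⟨ ∣p∩q∣+∣p─q∣≡∣p∣ S (P h) ⟩
          ∣ S ∣                               ∎

      FreeCostly : Set
      FreeCostly = Cost≥ (P nothing) (A ∪ (U ─ P nothing)) (suc (opt (P nothing)))

      ∣S∩D∣+∣⊥∣≤ : ∀ (S D D′ : Subset n) → D ⊆ D′ → ∣ S ∩ D ∣ + ∣ ⊥ {n} ∣ ≤ ∣ S ∩ D′ ∣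
      ∣S∩D∣+∣⊥∣≤ S D D′ D⊆D′ rewrite ∣⊥∣≡0 n = ≤-trans (≤-reflexive (+-identityʳ _))
        (p⊆q⇒∣p∣≤∣q∣ {p = S ∩ D} {q = S ∩ D′} λ v∈ → let v∈S , v∈D = ∈∩⁻ v∈ in x∈p∩q⁺ (v∈S , D⊆D′ v∈D))

      +∣⊥∣ : ∀ k → k + ∣ ⊥ {n} ∣ ≡ k
      +∣⊥∣ k = trans (cong (k +_) (∣⊥∣≡0 n)) (+-identityʳ k)

      extract-free : FreeCostly → Extract (e (suc j) + d j) (λ L → CostL≥ L U A Q)
      extract-free costly = extract-map ≤-refl (λ b S sol → b S sol (λ _ → id) (λ _ → id) (∣S∩D∣+∣⊥∣≤ S _ _ id))
        (extract-part nothing id id P-nothing∌X (λ v∈⊥ → contradiction v∈⊥ ∉⊥)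
          (λ v∈P v∉P → contradiction v∈P v∉P) (λ v∈P _ v∈X → contradiction v∈X (P-nothing∌X v∈P)) id
          (+∣⊥∣ _) (≤-reflexive (≡.sym (+-suc _ j))) costly)

      extract-in : ∀ {x} → x ∈ X → InCostly x →
        Extract (e (suc j) + d j) (λ L → ∀ S → SolutionL L U A S → x ∈ S → Q ≤ ∣ S ∣)
      extract-in {x} x∈X costly = extract-map ≤-refl
        (λ b S sol x∈S → b S sol (λ _ → id) (λ _ → id) (larger x∈S))
        (extract-part (just x) R⊆V id R∌X
          (λ v∈x → subst (_∈ U) (≡.sym (x∈⁅y⁆⇒x≡y x v∈x)) (X⊆U x∈X))
          (λ v∈V v∉R → [ (λ { refl → x∈⁅x⁆ x }) , (λ v∈R → contradiction v∈R v∉R) ]′ (V-cases v∈V))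
          (λ v∈V _ v∈X → subst (_∈ ⁅ x ⁆) (≡.sym (P∩X v∈V v∈X)) (x∈⁅x⁆ x)) id
          (trans (cong (opt (V x) +_) (∣⁅x⁆∣≡1 x)) (+-comm _ 1))
          -- `opt (V x)` may exceed `opt (R x)` by one, hence excess `suc j` on `R x`.
          (≤-trans (+-monoˡ-≤ j (opt-V≤ x)) (≤-reflexive (≡.sym (+-suc _ j)))) costly)
        where
        larger : x ∈ S → ∣ S ∩ R x ∣ + ∣ ⁅ x ⁆ ∣ ≤ ∣ S ∩ V x ∣
        larger {S} x∈S = ≤-trans (≤-reflexive (trans (cong (∣ S ∩ R x ∣ +_) (∣⁅x⁆∣≡1 x)) (+-comm _ 1)))
          (p⊂q⇒∣p∣<∣q∣ {p = S ∩ R x} {q = S ∩ V x} ((λ v∈ → let v∈S , v∈R = ∈∩⁻ v∈ in x∈p∩q⁺ (v∈S , R⊆V v∈R)) ,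
            x , x∈p∩q⁺ (x∈S , ∈P-self x∈X) , λ x∈ → x∉p-x (proj₂ (∈∩⁻ x∈))))

      -- The threshold is one above `opt (V x)`, which may be one above `opt (R x)`. This is the
      -- only branch whose excess on the lower level exceeds that on `U`.
      extract-out : ∀ {x} → x ∈ X → OutCostly x →
        Extract (e (suc (suc j)) + d j) (λ L → ∀ S → SolutionL L U A S → x ∉ S → Q ≤ ∣ S ∣)
      extract-out {x} x∈X costly = extract-map ≤-refl
        (λ b S sol x∉S → let trace = λ {v} v∈S v∈V → [ (λ { refl → contradiction v∈S x∉S }) , id ]′ (V-cases {v} v∈V)
          in b S sol trace trace (∣S∩D∣+∣⊥∣≤ S (R x) (V x) R⊆V))
        (extract-part (just x) R⊆V R⊆V R∌X (λ v∈⊥ → contradiction v∈⊥ ∉⊥)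
          (λ v∈V v∉V → contradiction v∈V v∉V) (λ v∈R _ v∈X → contradiction v∈X (R∌X v∈R)) R⊆V
          (+∣⊥∣ _) (≤-trans (s≤s (+-monoˡ-≤ j (opt-V≤ x)))
            (≤-reflexive (≡.sym (trans (+-suc _ (suc j)) (cong suc (+-suc _ j)))))) costly)

      -- The obstruction to a cheap solution: some vertex of `Z` in `X` has to be chosen, and each
      -- choice is expensive.
      Forced : Subset n → Set
      Forced Z = H Z × ¬ Meets A Z × (∀ v → v ∈ Z → v ∈ U → v ∈ X × InCostly v)

      forced? : Decidable Forced
      forced? Z = H? Z ×-dec ¬? (meets? A Z) ×-dec Fin.all? λ v →
        (v ∈? Z) →-dec (v ∈? U) →-dec (v ∈? X) ×-dec cost≥? _ _ _

      extract-forced : ∀ Z → Forced Z → Extract (1 + t * (e (suc j) + d j)) (λ L → CostL≥ L U A Q)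
      extract-forced Z (HZ , ¬meets , forced) = extract-map (s≤s (*-monoˡ-≤ (e (suc j) + d j) (H-size HZ))) conclude
        (extract-× (λ sub → sub) (λ sub b v v∈Z S → b v v∈Z S ∘ weaken sub)
          (Z ∷ [] , (λ { (here refl) → HZ }) , ≤-refl , here refl)
          (extract-∀∈Subset (λ v sub b S → b S ∘ weaken sub) Z branch))
        where
        branch : ∀ v → v ∈ Z →
          Extract (e (suc j) + d j) (λ L → ∀ S → SolutionL L U A S → v ∈ S → Q ≤ ∣ S ∣)
        branch v v∈Z with v ∈? U
        ... | yes v∈U = let v∈X , costly = forced v v∈Z v∈U in extract-in v∈X costly
        ... | no v∉U = [] , (λ ()) , z≤n , λ S (S⊆U , _) v∈S → contradiction (S⊆U v∈S) v∉U

        conclude : ∀ {L} → Z ∈ˡ L × (∀ v → v ∈ Z → ∀ S → SolutionL L U A S → v ∈ S → Q ≤ ∣ S ∣) →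
                   CostL≥ L U A Q
        conclude (Z∈L , b) S sol@(_ , _ , meets) with meets Z Z∈L
        ... | v , v∈ , v∈Z with ∈∪⁻ v∈
        ...   | inj₁ v∈A = contradiction (v , v∈A , v∈Z) ¬meets
        ...   | inj₂ v∈S = b v v∈Z S sol v∈S

      -- No branch available: assembling a cheap solution

      Piece : Maybe (Fin n) → Subset n → Set
      Piece h T = Solution (P h) (A ∪ (U ─ P h)) T × ∣ T ∣ ≤ opt (P h)

      piece-in : ∀ {x} → x ∈ X → ¬ InCostly x → ∃ λ T → Piece (just x) T × x ∈ T
      piece-in {x} x∈X ¬costly with cost≱⇒solution ¬costly
      ... | S , (S⊆R , hits , sol) , ∣S∣< = S ∪ ⁅ x ⁆ ,
        ((T⊆V , hitsCliques-V hits (∈∪ʳ (x∈⁅x⁆ x)) ∈∪ˡ ,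
          λ Z HZ → case sol Z HZ of λ (v , v∈ , v∈Z) → v , step v∈ , v∈Z) ,
         ≤-trans (∣p∪⁅x⁆∣≤1+∣p∣ S x) ∣S∣<) , ∈∪ʳ (x∈⁅x⁆ x)
        where
        T⊆V : S ∪ ⁅ x ⁆ ⊆ V x
        T⊆V v∈ = case ∈∪⁻ v∈ of λ where
          (inj₁ v∈S) → R⊆V (S⊆R v∈S)
          (inj₂ v∈x) → subst (_∈ V x) (≡.sym (x∈⁅y⁆⇒x≡y x v∈x)) (∈P-self x∈X)

        step : ∀ {v} → v ∈ (A ∪ (U ─ R x)) ∪ S → v ∈ (A ∪ V̄ x) ∪ (S ∪ ⁅ x ⁆)
        step {v} v∈ with ∈∪⁻ v∈
        ... | inj₂ v∈S = ∈∪ʳ (∈∪ˡ v∈S)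
        ... | inj₁ v∈A∪ with ∈∪⁻ v∈A∪ | v Fin.≟ x
        ...   | inj₁ v∈A | _ = ∈∪ˡ (∈∪ˡ v∈A)
        ...   | inj₂ v∈ | yes refl = ∈∪ʳ (∈∪ʳ (x∈⁅x⁆ x))
        ...   | inj₂ v∈ | no v≢x = let v∈U , v∉R = ∈─⁻ v∈ in
          ∈∪ˡ (∈∪ʳ (x∈p∧x∉q⇒x∈p─q v∈U λ v∈V → v∉R (x∈p∧x≢y⇒x∈p-y v∈V v≢x)))

      -- The t-cliques through `x` are hit as well: they belong to `H`, and nothing granted lies in
      -- `V x`.
      piece-out : ∀ {x} → ¬ OutCostly x → ∃ λ T → Piece (just x) T
      piece-out {x} ¬costly with cost≱⇒solution ¬costly
      ... | T , (T⊆R , _ , sol) , ∣T∣< = T , ((λ v∈T → R⊆V (T⊆R v∈T)) , hits , sol) , s≤s⁻¹ ∣T∣<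
        where
        hits : HitsCliques (V x) T
        hits K K⊆V c with sol K (TClique⇒H c)
        ... | v , v∈ , v∈K with ∈∪⁻ v∈
        ...   | inj₁ v∈A∪ = contradiction (K⊆V v∈K) (dis-∪─ id P⊆U v∈A∪)
        ...   | inj₂ v∈T = v , v∈T , v∈K

      module _ (¬free : ¬ FreeCostly)
               (¬both : ∀ {x} → x ∈ X → InCostly x → ¬ OutCostly x)
               (¬forced : ∀ Z → ¬ Forced Z) where

        -- A root vertex is taken whenever this is affordable, so one that is left out is known to
        -- be `InCostly`.
        pieces : ∀ x → ∃ λ T → x ∈ X → Piece (just x) T × (x ∈ T ⊎ InCostly x)
        pieces x with x ∈? X | cost≥? (R x) (A ∪ (U ─ R x)) (opt (V x))
        ... | no x∉X | _ = ⊥ , λ x∈X → contradiction x∈X x∉X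
        ... | yes x∈X | no ¬costly = let T , piece , x∈T = piece-in x∈X ¬costly in T , λ _ → piece , inj₁ x∈T
        ... | yes x∈X | yes costly = let T , piece = piece-out (¬both x∈X costly) in T , λ _ → piece , inj₂ costly

        local : Fin n → Subset n
        local x = proj₁ (pieces x)

        T-piece : ∀ {x} → x ∈ X → Piece (just x) (local x)
        T-piece x∈X = proj₁ (proj₂ (pieces _) x∈X)

        T-in : ∀ {x} → x ∈ X → ¬ InCostly x → x ∈ local x
        T-in x∈X ¬costly = [ id , (λ costly → contradiction costly ¬costly) ]′ (proj₂ (proj₂ (pieces _) x∈X))

        free-piece : ∃ λ T₀ → Piece nothing T₀
        free-piece = let T₀ , sol , ∣T₀∣< = cost≱⇒solution ¬free in T₀ , sol , s≤s⁻¹ ∣T₀∣<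

        T₀ : Subset n
        T₀ = proj₁ free-piece

        replace-piece : ∀ h {S T} → S ⊆ U × HitsCliques U S × ∣ S ∣ ≤ opt U → Piece h T →
          let S′ = (S ─ P h) ∪ T in S′ ⊆ U × HitsCliques U S′ × ∣ S′ ∣ ≤ opt U
        replace-piece h (S⊆U , hits , ∣S∣≤) ((T⊆P , hitsT , _) , ∣T∣≤) =
          (λ v∈ → [ S⊆U ∘ proj₁ ∘ ∈─⁻ , P⊆U ∘ T⊆P ]′ (∈∪⁻ v∈)) , proj₁ r , ≤-trans (proj₂ r) ∣S∣≤
          where r = replace P⊆U (P-separates h) hits hitsT ∣T∣≤

        -- Starting from an optimal hitting set, pieces are swapped in by exchange; parts are
        -- disjoint, so earlier pieces survive.
        assemble : ∀ xs → ∃ λ S → (S ⊆ U × HitsCliques U S × ∣ S ∣ ≤ opt U) × T₀ ⊆ S ×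
                                  (∀ x → x ∈ X → x ∈ˡ xs → local x ⊆ S)
        assemble [] = _ , replace-piece nothing (proj₂ (optimal U)) (proj₂ free-piece) , ∈∪ʳ , λ _ _ ()
        assemble (x ∷ xs) with assemble xs | x ∈? X
        ... | S , good , T₀⊆S , T⊆S | no x∉X = S , good , T₀⊆S , λ where
          y y∈X (here refl) → contradiction y∈X x∉X
          y y∈X (there y∈) → T⊆S y y∈X y∈
        ... | S , good , T₀⊆S , T⊆S | yes x∈X = _ , replace-piece (just x) good (T-piece x∈X) ,
          keep nothing T₀⊆S (proj₁ (proj₁ (proj₂ free-piece))) (λ ()) , λ where
            y y∈X (here refl) → ∈∪ʳ
            y y∈X (there y∈) → other y y∈X (T⊆S y y∈X y∈) (y Fin.≟ x)
          where
          keep : ∀ h {T′} → T′ ⊆ S → T′ ⊆ P h → h ≢ just x → T′ ⊆ (S ─ P (just x)) ∪ local x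
          keep h T′⊆S T′⊆P h≢ v∈ = ∈∪ˡ (x∈p∧x∉q⇒x∈p─q (T′⊆S v∈) λ v∈P →
            h≢ (trans (≡.sym (proj₂ (∈P⁻ (T′⊆P v∈)))) (proj₂ (∈P⁻ v∈P))))

          other : ∀ y → y ∈ X → local y ⊆ S → Dec (y ≡ x) → local y ⊆ (S ─ P (just x)) ∪ local x
          other y y∈X Ty⊆S (yes refl) = ∈∪ʳ
          other y y∈X Ty⊆S (no y≢x) =
            keep (just y) Ty⊆S (proj₁ (proj₁ (T-piece y∈X))) (y≢x ∘ just-injective)

        -- A set of `H` with a vertex of `U` off `X` stays in one part within `U`, so that piece
        -- hits it without outside help unless `A` does. A set missed by `A` and meeting `U` only in
        -- `X` contains a chosen root vertex, since it would be `Forced` otherwise.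
        settled : ∃ λ S → Solution U A S × ∣ S ∣ ≤ opt U
        settled with assemble (allFin n)
        ... | S , (S⊆U , hits , ∣S∣≤) , T₀⊆S , T⊆S = S , (S⊆U , hits , sol) , ∣S∣≤
          where
          part : ∀ h → (∀ {x} → h ≡ just x → x ∈ X) → ∃ λ T′ → T′ ⊆ S × Piece h T′
          part nothing _ = T₀ , T₀⊆S , proj₂ free-piece
          part (just x) ∈X = local x , T⊆S x (∈X refl) (∈-allFin x) , T-piece (∈X refl)

          sol : ∀ Z → H Z → Meets (A ∪ S) Z
          sol Z HZ with meets? A Z
                      | Fin.any? (λ v → (v ∈? Z) ×-dec (v ∈? U) ×-dec ¬? (v ∈? X))
                      | Fin.any? (λ v → (v ∈? Z) ×-dec (v ∈? X) ×-dec ¬? (cost≥? (R v) (A ∪ (U ─ R v)) (opt (V v))))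
          ... | yes (v , v∈A , v∈Z) | _ | _ = v , ∈∪ˡ v∈A , v∈Z
          ... | no _ | no _ | yes (v , v∈Z , v∈X , ¬costly) =
            v , ∈∪ʳ (T⊆S v v∈X (∈-allFin v) (T-in v∈X ¬costly)) , v∈Z
          ... | no ¬meets | no ¬out | no ¬cheap = contradiction (HZ , ¬meets , λ v v∈Z v∈U →
              let v∈X = decidable-stable (v ∈? X) λ v∉X → ¬out (v , v∈Z , v∈U , v∉X) in
              v∈X , decidable-stable (cost≥? _ _ _) λ ¬costly → ¬cheap (v , v∈Z , v∈X , ¬costly))
            (¬forced Z)
          ... | no _ | yes (v , v∈Z , v∈U , v∉X) | _ with part (home v) (home-X v∈U)
          ...   | T′ , T′⊆S , (_ , _ , sol′) , _ with sol′ Z HZ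
          ...     | u , u∈ , u∈Z with ∈∪⁻ u∈
          ...       | inj₂ u∈T′ = u , ∈∪ʳ (T′⊆S u∈T′) , u∈Z
          ...       | inj₁ u∈A∪ with ∈∪⁻ u∈A∪
          ...         | inj₁ u∈A = u , ∈∪ˡ u∈A , u∈Z
          ...         | inj₂ u∈U─P = let u∈U , u∉P = ∈─⁻ u∈U─P in
            contradiction (clique⊆P (H-clique HZ) v∈Z (∈P⁺ v∈U refl) v∉X u∈Z u∈U) u∉P

      -- If no branch were available, `settled` would give a solution of cost `opt U`, against the
      -- positive excess.
      extract-root : 2 ≤ t → 1 + t * (e (suc j) + d j) + e (suc (suc j)) ≤ d (suc j) →
                     Extract (d (suc j)) (λ L → CostL≥ L U A Q)
      extract-root 2≤t bound
        with cost≥? (P nothing) (A ∪ (U ─ P nothing)) (suc (opt (P nothing)))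
           | Fin.any? (λ x → (x ∈? X) ×-dec cost≥? (R x) (A ∪ (U ─ R x)) (opt (V x))
                                      ×-dec cost≥? (R x) (A ∪ V̄ x) (suc (opt (V x))))
           | anySubset? forced?
      ... | yes costly | _ | _ = extract-map (≤-trans c≤ bound) id (extract-free costly)
        where
        c≤ : e (suc j) + d j ≤ 1 + t * (e (suc j) + d j) + e (suc (suc j))
        c≤ = ≤-trans (m≤n*m _ t {{>-nonZero 0<t}}) (≤-trans (n≤1+n _) (m≤m+n _ _))
      ... | no _ | yes (x , x∈X , costlyIn , costlyOut) | _ = extract-map (≤-trans c≤ bound)
          (λ (bin , bout) S sol → case x ∈? S of λ where
            (yes x∈S) → bin S sol x∈S
            (no x∉S) → bout S sol x∉S)
          (extract-× (λ sub b S → b S ∘ weaken sub) (λ sub b S → b S ∘ weaken sub)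
            (extract-in x∈X costlyIn) (extract-out x∈X costlyOut))
        where
        open ≤-Reasoning
        c = e (suc j) + d j
        -- `t ≥ 2` copies of `c` pay for the inside branch and for the `d j` of the outside branch,
        -- so the bound for a forced set serves all cases.
        c≤ : c + (e (suc (suc j)) + d j) ≤ 1 + t * c + e (suc (suc j))
        c≤ = begin
          c + (e (suc (suc j)) + d j)  ≡⟨ cong (c +_) (+-comm _ (d j)) ⟩
          c + (d j + e (suc (suc j)))  ≡⟨ +-assoc c _ _ ⟨
          c + d j + e (suc (suc j))    ≤⟨ +-monoˡ-≤ _ (+-monoʳ-≤ c (m≤n+m (d j) _)) ⟩
          c + c + e (suc (suc j))      ≡⟨ cong (λ z → c + z + e (suc (suc j))) (+-identityʳ c) ⟨
          2 * c + e (suc (suc j))      ≤⟨ +-monoˡ-≤ _ (*-monoˡ-≤ c 2≤t) ⟩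
          t * c + e (suc (suc j))      ≤⟨ n≤1+n _ ⟩
          1 + t * c + e (suc (suc j))  ∎
      ... | no _ | no _ | yes (Z , forced) =
        extract-map (≤-trans (m≤m+n _ _) bound) id (extract-forced Z forced)
      ... | no ¬free | no ¬both | no ¬forced =
        let S , sol , ∣S∣≤ = settled ¬free (λ x∈X i o → ¬both (_ , x∈X , i , o)) (λ Z f → ¬forced (Z , f))
        in contradiction (≤-trans (cost S sol) ∣S∣≤) (<⇒≱ (m<m+n (opt U) z<s))

  bounded-root : ∀ {home e d} → 2 ≤ t →
    (∀ j → 1 + t * (e (suc j) + d j) + e (suc (suc j)) ≤ d (suc j)) →
    ∀ {X U} → Rooted home X U → (∀ {D} → D ⊆ U → (∀ {v} → v ∈ D → v ∉ X) → Bounded e D) → Bounded d U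
  bounded-root {e = e} {d} 2≤t bound rooted bounded zero A q dis q≤ cost =
    extract-trivial (≤-trans q≤ (≤-reflexive (+-identityʳ _)))
  bounded-root {home} {e} {d} 2≤t bound {X} {U} rooted bounded (suc j) A q dis q≤ cost with q ≤? opt U + j
  -- Branching wants `q` to be exactly `opt U + suc j`; smaller targets fall to excess `j`.
  ... | yes q≤′ = extract-map d≤ id (bounded-root {home} {e} {d} 2≤t bound rooted bounded j A q dis q≤′ cost)
    where
    d≤ : d j ≤ d (suc j)
    d≤ = ≤-trans (m≤n+m (d j) (e (suc j))) (≤-trans (m≤n*m _ t {{>-nonZero 0<t}})
      (≤-trans (n≤1+n _) (≤-trans (m≤m+n _ _) (bound j))))
  ... | no q≰ with ≤-antisym q≤ (≤-trans (≤-reflexive (+-suc _ j)) (≰⇒> q≰))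
  ...   | refl = extract-root rooted e d j bounded
    (λ h A q → bounded-root {home} {e} {d} 2≤t bound (restrict rooted h) (bounded′ h) j A q)
    dis cost 2≤t (bound j)
    where
    bounded′ : ∀ h {D} → D ⊆ U ─ Part home U h → (∀ {v} → v ∈ D → v ∉ X ─ Part home U h) → Bounded e D
    bounded′ h D⊆ D∌ = bounded (⊆-trans D⊆ (p─q⊆p U _)) λ v∈D v∈X →
      D∌ v∈D (x∈p∧x∉q⇒x∈p─q v∈X (proj₂ (∈─⁻ (D⊆ v∈D))))

-- Ranking the vertices along bed⁺

double : ℕ → ℕ
double zero = zero
double (suc k) = suc (suc (double k))

double≢1+double : ∀ k m → double k ≢ suc (double m)
double≢1+double (suc k) (suc m) eq = double≢1+double k m (suc-injective (suc-injective eq))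

belowRank? : ∀ (r : Fin n → ℕ) s U → Decidable (λ v → v ∈ U × r v < s)
belowRank? r s U v = (v ∈? U) ×-dec (r v <? s)

belowRank : (Fin n → ℕ) → ℕ → Subset n → Subset n
belowRank r s U = comprehension (belowRank? r s U)

∈belowRank⁺ : ∀ {r : Fin n → ℕ} {s U} → v ∈ U → r v < s → v ∈ belowRank r s U
∈belowRank⁺ v∈U r< = ∈-comprehension⁺ (belowRank? _ _ _) (v∈U , r<)

∈belowRank⁻ : ∀ {r : Fin n → ℕ} {s U} → v ∈ belowRank r s U → v ∈ U × r v < s
∈belowRank⁻ = ∈-comprehension⁻ (belowRank? _ _ _)

module _ {n} (G : Graph n) where

  private variable
    u w : Fin n
    U U′ C : Subset n

  edge-sym : Edge G u v → Edge G v u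
  edge-sym {u} {v} = subst T (Graph.sym G u v)

  source∈ : PathIn G U u v → u ∈ U
  source∈ (here u∈U) = u∈U
  source∈ (there u∈U _ _) = u∈U

  target∈ : PathIn G U u v → v ∈ U
  target∈ (here u∈U) = u∈U
  target∈ (there _ _ path) = target∈ path

  path-trans : PathIn G U u v → PathIn G U v w → PathIn G U u w
  path-trans (here _) path = path
  path-trans (there u∈U e path) path′ = there u∈U e (path-trans path path′)

  path-sym : PathIn G U u v → PathIn G U v u
  path-sym (here u∈U) = here u∈U
  path-sym (there u∈U e path) = path-trans (path-sym path) (there (source∈ path) (edge-sym e) (here u∈U))

  -- Only vertices reached from `u` are tested, so a path can be moved into the component it runs
  -- in.
  path-map : (∀ {w} → PathIn G U u w → w ∈ U′) → PathIn G U u v → PathIn G U′ u v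
  path-map f (here u∈U) = here (f (here u∈U))
  path-map f (there u∈U e path) =
    there (f (here u∈U)) e (path-map (λ p → f (there u∈U e p)) path)

  path-mono : U ⊆ U′ → PathIn G U u v → PathIn G U′ u v
  path-mono U⊆U′ = path-map (U⊆U′ ∘ target∈)

  -- Rank 2k holds vertices deleted as lying in no t-clique, rank 2k + 1 the roots taken at depth k.
  record Ranked (t : ℕ) (r : Fin n → ℕ) (U : Subset n) : Set where
    field
      even-free : ∀ k {K v} → K ⊆ U → TClique G t K → v ∈ K → r v ≡ double k →
                  ¬ (∀ {u} → u ∈ K → r u ≤ double k)
      odd-free  : ∀ k {K} → K ⊆ U → TClique G t K → ¬ (∀ {u} → u ∈ K → r u ≡ suc (double k))
      attached  : ∀ k {x x′ c c′} → x ∈ U → x′ ∈ U → r x ≡ suc (double k) → r x′ ≡ suc (double k) →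
                  PathIn G (belowRank r (suc (double k)) U) c c′ → Edge G c x → Edge G c′ x′ → x ≡ x′

  ranked-⊆ : ∀ {t r} → U′ ⊆ U → Ranked t r U → Ranked t r U′
  ranked-⊆ U′⊆U ranked = record
    { even-free = λ k K⊆ → even-free k (⊆-trans K⊆ U′⊆U)
    ; odd-free = λ k K⊆ → odd-free k (⊆-trans K⊆ U′⊆U)
    ; attached = λ k x∈ x′∈ rx rx′ path → attached k (U′⊆U x∈) (U′⊆U x′∈) rx rx′
        (path-mono (λ v∈ → let v∈U′ , r< = ∈belowRank⁻ v∈ in ∈belowRank⁺ (U′⊆U v∈U′) r<) path)
    }
    where open Ranked ranked

  module Rank {t} (0<t : 0 < t) (path? : ∀ U u v → Dec (PathIn G U u v)) where

    component : Subset n → Fin n → Subset n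
    component U v = comprehension (path? U v)

    ∈component⁺ : PathIn G U v u → u ∈ component U v
    ∈component⁺ = ∈-comprehension⁺ (path? _ _)

    ∈component⁻ : u ∈ component U v → PathIn G U v u
    ∈component⁻ = ∈-comprehension⁻ (path? _ _)

    component-isComponent : v ∈ U → Component G U (component U v)
    component-isComponent {v} {U} v∈U =
      target∈ ∘ ∈component⁻ ,
      (v , ∈component⁺ (here v∈U)) ,
      (λ u w u∈ w∈ → path-map (λ p → ∈component⁺ (path-trans (∈component⁻ u∈) p))
        (path-trans (path-sym (∈component⁻ u∈)) (∈component⁻ w∈))) ,
      (λ u w u∈ w∈U e → ∈component⁺ (path-trans (∈component⁻ u∈) (there (target∈ (∈component⁻ u∈)) e (here w∈U))))

    component-≡ : PathIn G U u v → component U u ≡ component U v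
    component-≡ path = ⊆-antisym
      (λ w∈ → ∈component⁺ (path-trans (path-sym path) (∈component⁻ w∈)))
      (λ w∈ → ∈component⁺ (path-trans path (∈component⁻ w∈)))

    component? : ∀ U C → Dec (Component G U C)
    component? U C = (C ⊆? U) ×-dec nonempty? C
      ×-dec (Fin.all? λ u → Fin.all? λ v → (u ∈? C) →-dec (v ∈? C) →-dec path? C u v)
      ×-dec (Fin.all? λ u → Fin.all? λ v →
        (u ∈? C) →-dec (v ∈? U) →-dec T? (Graph.adj G u v) →-dec (v ∈? C))

    Ranking : Subset n → ℕ → Set
    Ranking U k = ∃ λ r → Ranked t r U × (∀ {v} → v ∈ U → r v ≤ double k)

    ranking-empty : ∀ {k} → Empty U → Ranking U k
    ranking-empty ∄U = (λ _ → 0) , record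
      { even-free = λ k K⊆U c v∈K _ → contradiction (_ , K⊆U v∈K) ∄U
      ; odd-free = λ k K⊆U c → let v , v∈K = TClique-nonempty G 0<t c in contradiction (v , K⊆U v∈K) ∄U
      ; attached = λ k x∈U → contradiction (_ , x∈U) ∄U
      } , λ v∈U → contradiction (_ , v∈U) ∄U

    -- `v` takes the top even rank. It is in no t-clique, so both freeness conditions ignore it; it
    -- lies above every odd rank in use, so no path tested by `attached` visits it.
    ranking-del : ∀ {k} → ¬ InTClique G t U v → Ranking (U - v) k → Ranking U k
    ranking-del {U} {v} {k} v∉clique (r , ranked , r≤) = r′ , record
      { even-free = λ m K⊆U c w∈K rw all → even-free m (avoid K⊆U c) c w∈K
          (trans (≡.sym (r′≡r (∈K⇒≢ K⊆U c w∈K))) rw)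
          (λ u∈K → subst (_≤ _) (r′≡r (∈K⇒≢ K⊆U c u∈K)) (all u∈K))
      ; odd-free = λ m K⊆U c all → odd-free m (avoid K⊆U c) c
          (λ u∈K → trans (≡.sym (r′≡r (∈K⇒≢ K⊆U c u∈K))) (all u∈K))
      ; attached = λ m x∈U x′∈U rx rx′ path →
          let x≢v = odd⇒≢ m rx ; x′≢v = odd⇒≢ m rx′
              x∈ = x∈p∧x≢y⇒x∈p-y x∈U x≢v ; x′∈ = x∈p∧x≢y⇒x∈p-y x′∈U x′≢v
              rx≡ = trans (≡.sym (r′≡r x≢v)) rx
          in attached m x∈ x′∈ rx≡ (trans (≡.sym (r′≡r x′≢v)) rx′)
               (path-mono (below m (subst (_≤ double k) rx≡ (r≤ x∈))) path)
      } , bound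
      where
      open Ranked ranked

      r′ : Fin n → ℕ
      r′ u with u Fin.≟ v
      ... | yes _ = double k
      ... | no _ = r u

      r′≡r : u ≢ v → r′ u ≡ r u
      r′≡r {u} u≢v with u Fin.≟ v
      ... | yes u≡v = contradiction u≡v u≢v
      ... | no _ = refl

      r′v : r′ v ≡ double k
      r′v with v Fin.≟ v
      ... | yes _ = refl
      ... | no v≢v = contradiction refl v≢v

      ∈K⇒≢ : ∀ {K} → K ⊆ U → TClique G t K → u ∈ K → u ≢ v
      ∈K⇒≢ K⊆U c u∈K refl = v∉clique (_ , K⊆U , c , u∈K)

      avoid : ∀ {K} → K ⊆ U → TClique G t K → K ⊆ U - v
      avoid K⊆U c u∈K = x∈p∧x≢y⇒x∈p-y (K⊆U u∈K) (∈K⇒≢ K⊆U c u∈K)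

      odd⇒≢ : ∀ m → r′ u ≡ suc (double m) → u ≢ v
      odd⇒≢ m eq refl = double≢1+double k m (trans (≡.sym r′v) eq)

      below : ∀ m → suc (double m) ≤ double k →
              belowRank r′ (suc (double m)) U ⊆ belowRank r (suc (double m)) (U - v)
      below m m< {u} u∈ with ∈belowRank⁻ u∈ | u Fin.≟ v
      ... | u∈U , r< | yes refl = contradiction (≤-trans (subst (_< _) r′v r<) m<) (<-irrefl refl)
      ... | u∈U , r< | no u≢v = ∈belowRank⁺ (x∈p∧x≢y⇒x∈p-y u∈U u≢v) (subst (_< _) (r′≡r u≢v) r<)

      bound : ∀ {u} → u ∈ U → r′ u ≤ double k
      bound {u} u∈U with u Fin.≟ v
      ... | yes _ = ≤-refl
      ... | no u≢v = r≤ (x∈p∧x≢y⇒x∈p-y u∈U u≢v)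

    -- Cliques, and paths with their attaching edges, stay inside one component, so the rankings are
    -- glued without any shift.
    ranking-split : ∀ {k} → (∀ C → Component G U C → Ranking C k) → Ranking U k
    ranking-split {U} {k} ranking = r , record
      { even-free = λ m K⊆U c v∈K rv all → let K⊆C = On.clique⊆ (K⊆U v∈K) K⊆U c v∈K in
          On.even-free (K⊆U v∈K) m K⊆C c v∈K rv
            λ u∈K → subst (_≤ _) (r≡ (∈component⁻ (K⊆C u∈K))) (all u∈K)
      ; odd-free = λ m K⊆U c all →
          let v , v∈K = TClique-nonempty G 0<t c ; K⊆C = On.clique⊆ (K⊆U v∈K) K⊆U c v∈K in
          On.odd-free (K⊆U v∈K) m K⊆C c
            λ u∈K → trans (≡.sym (r≡ (∈component⁻ (K⊆C u∈K)))) (all u∈K)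
      ; attached = λ m x∈U x′∈U rx rx′ path e e′ →
          let toX′ = path-trans (enter x∈U e (inU path)) (there (target∈ (inU path)) e′ (here x′∈U)) in
          On.attached x∈U m (∈component⁺ (here x∈U)) (∈component⁺ toX′) rx
            (trans (≡.sym (r≡ toX′)) rx′)
            (path-map (λ p → ∈belowRank⁺ (∈component⁺ (enter x∈U e (inU p)))
              (subst (_< _) (r≡ (enter x∈U e (inU p))) (proj₂ (∈belowRank⁻ (target∈ p))))) path)
            e e′
      } , bound
      where
      -- Taking the proof from `component?` makes the ranking depend on the set alone, so vertices
      -- of one component share it. The default 0 is never met on a component.
      rankOn : Subset n → Fin n → ℕ
      rankOn C with component? U C
      ... | yes comp = proj₁ (ranking C comp)
      ... | no _ = λ _ → 0

      rankOn-ranked : Component G U C → Ranked t (rankOn C) C × (∀ {v} → v ∈ C → rankOn C v ≤ double k)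
      rankOn-ranked {C} comp with component? U C
      ... | yes comp = proj₂ (ranking C comp)
      ... | no ¬comp = contradiction comp ¬comp

      r : Fin n → ℕ
      r v = rankOn (component U v) v

      r≡ : PathIn G U v u → r u ≡ rankOn (component U v) u
      r≡ path = cong (λ C → rankOn C _) (≡.sym (component-≡ path))

      inU : ∀ {r : Fin n → ℕ} {s} → PathIn G (belowRank r s U) u w → PathIn G U u w
      inU = path-mono (proj₁ ∘ ∈belowRank⁻)

      enter : ∀ {c x} → x ∈ U → Edge G c x → PathIn G U c w → PathIn G U x w
      enter x∈U e = there x∈U (edge-sym e)

      module On {v} (v∈U : v ∈ U) where
        ranked = rankOn-ranked (component-isComponent v∈U)
        open Ranked (proj₁ ranked) public

        clique⊆ : ∀ {K} → K ⊆ U → TClique G t K → v ∈ K → K ⊆ component U v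
        clique⊆ K⊆U c v∈K {u} u∈K with u Fin.≟ v
        ... | yes refl = ∈component⁺ (here v∈U)
        ... | no u≢v = ∈component⁺ (there v∈U (proj₁ c _ _ v∈K u∈K (u≢v ∘ ≡.sym)) (here (K⊆U u∈K)))

      bound : ∀ {v} → v ∈ U → r v ≤ double k
      bound v∈U = proj₂ (On.ranked v∈U) (∈component⁺ (here v∈U))

    -- `X` gets the new top rank. At that rank `attached` is the root condition, because a path
    -- avoiding `X` stays in one component of `U ─ X`; lower layers do not see `X`.
    ranking-root : ∀ {X k} → Root G t U X → Ranking (U ─ X) k → Ranking U (suc k)
    ranking-root {U} {X} {k} (X⊆U , _ , _ , X-free , oneNeighbour) (r , ranked , r≤) = r′ , record
      { even-free = λ m K⊆U c v∈K rv all →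
          let v∉X = λ v∈X → double≢1+double m k (trans (≡.sym rv) (r′-in v∈X))
              rv≡ = trans (≡.sym (r′-out v∉X)) rv
              k≥m = subst (_≤ double k) rv≡ (r≤ (x∈p∧x∉q⇒x∈p─q (K⊆U v∈K) v∉X))
          in even-free m (λ u∈K → x∈p∧x∉q⇒x∈p─q (K⊆U u∈K) (≤⇒∉X k≥m (all u∈K))) c v∈K rv≡
               λ u∈K → subst (_≤ _) (r′-out (≤⇒∉X k≥m (all u∈K))) (all u∈K)
      ; odd-free = λ m K⊆U c all → let v , v∈K = TClique-nonempty G 0<t c in case v ∈? X of λ where
          (yes v∈X) → X-free _ (λ u∈K → ∈X (K⊆U u∈K) (trans (all u∈K) (trans (≡.sym (all v∈K)) (r′-in v∈X)))) c
          (no v∉X) →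
            let K∌X = λ u (u∈K : u ∈ _) → ∉X (K⊆U v∈K) v∉X (trans (all u∈K) (≡.sym (all v∈K))) in
            odd-free m (λ u∈K → x∈p∧x∉q⇒x∈p─q (K⊆U u∈K) (K∌X _ u∈K)) c
              λ u∈K → trans (≡.sym (r′-out (K∌X _ u∈K))) (all u∈K)
      ; attached = λ m {x} {x′} x∈U x′∈U rx rx′ path e e′ → case x ∈? X of λ where
          (yes x∈X) →
            let x′∈X = ∈X x′∈U (trans rx′ (trans (≡.sym rx) (r′-in x∈X)))
                path′ = path-mono (below m (≤-reflexive (suc-injective (trans (≡.sym rx) (r′-in x∈X))))) path
            in oneNeighbour′ (path-mono (proj₁ ∘ ∈belowRank⁻) path′) x∈X x′∈X e e′
          (no x∉X) →
            let x′∉X = ∉X x∈U x∉X (trans rx′ (≡.sym rx))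
                rx≡ = trans (≡.sym (r′-out x∉X)) rx
                x∈ = x∈p∧x∉q⇒x∈p─q x∈U x∉X
            in attached m x∈ (x∈p∧x∉q⇒x∈p─q x′∈U x′∉X) rx≡ (trans (≡.sym (r′-out x′∉X)) rx′)
                 (path-mono (below m (≤-trans (n≤1+n _) (subst (_≤ double k) rx≡ (r≤ x∈)))) path) e e′
      } , bound
      where
      open Ranked ranked

      r′ : Fin n → ℕ
      r′ u with u ∈? X
      ... | yes _ = suc (double k)
      ... | no _ = r u

      r′-in : u ∈ X → r′ u ≡ suc (double k)
      r′-in {u} u∈X with u ∈? X
      ... | yes _ = refl
      ... | no u∉X = contradiction u∈X u∉X

      r′-out : u ∉ X → r′ u ≡ r u
      r′-out {u} u∉X with u ∈? X
      ... | yes u∈X = contradiction u∈X u∉X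
      ... | no _ = refl

      small : u ∈ U → u ∉ X → r′ u < suc (double k)
      small u∈U u∉X = s≤s (subst (_≤ double k) (≡.sym (r′-out u∉X)) (r≤ (x∈p∧x∉q⇒x∈p─q u∈U u∉X)))

      ≤⇒∉X : ∀ {m} → double m ≤ double k → r′ u ≤ double m → u ∉ X
      ≤⇒∉X k≥m r≤m u∈X = <⇒≱ (subst (_≤ _) (r′-in u∈X) r≤m) k≥m

      ∈X : u ∈ U → r′ u ≡ suc (double k) → u ∈ X
      ∈X {u} u∈U eq = decidable-stable (u ∈? X) λ u∉X → <⇒≢ (small u∈U u∉X) eq

      ∉X : v ∈ U → v ∉ X → r′ u ≡ r′ v → u ∉ X
      ∉X v∈U v∉X eq u∈X = <⇒≢ (small v∈U v∉X) (trans (≡.sym eq) (r′-in u∈X))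

      below : ∀ m → double m ≤ double k →
              belowRank r′ (suc (double m)) U ⊆ belowRank r (suc (double m)) (U ─ X)
      below m m≤k {u} u∈ with ∈belowRank⁻ u∈ | u ∈? X
      ... | u∈U , r< | yes u∈X = contradiction (subst (_< _) (r′-in u∈X) r<) (≤⇒≯ (s≤s m≤k))
      ... | u∈U , r< | no u∉X = ∈belowRank⁺ (x∈p∧x∉q⇒x∈p─q u∈U u∉X) (subst (_< _) (r′-out u∉X) r<)

      oneNeighbour′ : ∀ {c c′ x x′} → PathIn G (U ─ X) c c′ → x ∈ X → x′ ∈ X →
                      Edge G c x → Edge G c′ x′ → x ≡ x′
      oneNeighbour′ {c} {c′} {x} {x′} path x∈X x′∈X e e′
        with oneNeighbour (component (U ─ X) c) (component-isComponent (source∈ path))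
      ... | _ , _ , unique = trans
        (unique x x∈X (x∉ x∈X) (c , ∈component⁺ (here (source∈ path)) , e))
        (≡.sym (unique x′ x′∈X (x∉ x′∈X) (c′ , ∈component⁺ path , e′)))
        where
        x∉ : ∀ {x} → x ∈ X → x ∉ component (U ─ X) c
        x∉ x∈X x∈C = proj₂ (∈─⁻ (target∈ (∈component⁻ x∈C))) x∈X

      bound : ∀ {v} → v ∈ U → r′ v ≤ double (suc k)
      bound {v} v∈U with v ∈? X
      ... | yes _ = n≤1+n _
      ... | no v∉X = ≤-trans (r≤ (x∈p∧x∉q⇒x∈p─q v∈U v∉X)) (≤-trans (n≤1+n _) (n≤1+n _))

    bedLe⇒ranking : ∀ {k} → BedLe G t U k → Ranking U k
    bedLe⇒ranking (empty ∄U) = ranking-empty ∄U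
    bedLe⇒ranking (del v _ v∉clique bed) = ranking-del v∉clique (bedLe⇒ranking bed)
    bedLe⇒ranking (split _ _ _ beds) = ranking-split λ C comp → bedLe⇒ranking (beds C comp)
    bedLe⇒ranking (root X _ _ _ isRoot bed) = ranking-root isRoot (bedLe⇒ranking bed)

-- The recurrences and the induction on the rank

mutual
  -- Bounds at excess `j` for ranks below `double k` and up to `double k`. They solve the hypotheses
  -- of `bounded-root` and `bounded-extend` with equality.
  lowBound highBound : ℕ → ℕ → ℕ → ℕ
  lowBound t zero zero = 0
  lowBound t zero (suc j) = 1
  lowBound t (suc k) zero = 0
  lowBound t (suc k) (suc j) =
    1 + t * (highBound t k (suc j) + lowBound t (suc k) j) + highBound t k (suc (suc j))

  highBound t k zero = 0
  highBound t k (suc j) = lowBound t k (suc j) * suc (t * highBound t k j)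

module _ {n} (G : Graph n) (path? : ∀ U u v → Dec (PathIn G U u v)) (t : ℕ) (2≤t : 2 ≤ t)
  (H : Subset n → Set) (H? : Decidable H)
  (H-clique : ∀ {Z} → H Z → IsClique G Z) (H-size : ∀ {Z} → H Z → ∣ Z ∣ ≤ t)
  (TClique⇒H : ∀ {K} → TClique G t K → H K) where

  private
    0<t : 0 < t
    0<t = ≤-trans (s≤s z≤n) 2≤t

  open Hitting G t 0<t H H? H-clique H-size TClique⇒H

  module _ {r : Fin n → ℕ} where

    module _ {k U} (ranked : Ranked G t r U) (r< : ∀ {v} → v ∈ U → r v < double (suc k)) where

      open Ranked ranked

      top? : Decidable (λ v → v ∈ U × r v ≡ suc (double k))
      top? v = (v ∈? U) ×-dec (r v ≟ suc (double k))

      X B : Subset n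
      X = comprehension top?
      B = belowRank r (suc (double k)) U

      Attached : Fin n → Fin n → Set
      Attached v x = x ∈ X × ∃ λ c → PathIn G B v c × Edge G c x

      attached? : ∀ v x → Dec (Attached v x)
      attached? v x = (x ∈? X) ×-dec Fin.any? λ c → path? B v c ×-dec T? (Graph.adj G c x)

      homeVia : ∀ v → Dec (v ∈ X) → Dec (∃ (Attached v)) → Maybe (Fin n)
      homeVia v (yes _) _ = just v
      homeVia v (no _) (yes (x , _)) = just x
      homeVia v (no _) (no _) = nothing

      home : Fin n → Maybe (Fin n)
      home v = homeVia v (v ∈? X) (Fin.any? (attached? v))

      X⁻ : v ∈ X → v ∈ U × r v ≡ suc (double k)
      X⁻ = ∈-comprehension⁻ top?

      ∈B : v ∈ U → v ∉ X → v ∈ B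
      ∈B v∈U v∉X = ∈belowRank⁺ v∈U (≤∧≢⇒< (s≤s⁻¹ (r< v∈U)) λ rv → v∉X (∈-comprehension⁺ top? (v∈U , rv)))

      home-own′ : v ∈ X → home v ≡ just v
      home-own′ {v} v∈X with v ∈? X
      ... | yes _ = refl
      ... | no v∉X = contradiction v∈X v∉X

      home-just : ∀ {x} → home v ≡ just x → x ∈ X
      home-just {v} eq with v ∈? X | Fin.any? (attached? v)
      home-just refl | yes v∈X | _ = v∈X
      home-just refl | no _ | yes (_ , x∈X , _) = x∈X

      -- The three paths join into one below the rank of the roots, so `attached` applies; hence the
      -- search in `home` has only one possible outcome.
      attached-unique : ∀ {u x y} → PathIn G B v u → Attached v x → Attached u y → x ≡ y
      attached-unique path (x∈X , c , p , e) (y∈X , c′ , p′ , e′) =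
        let x∈U , rx = X⁻ x∈X ; y∈U , ry = X⁻ y∈X in
        attached k x∈U y∈U rx ry (path-trans G (path-sym G p) (path-trans G path p′)) e e′

      home-attached : ∀ {x} → v ∉ X → Attached v x → home v ≡ just x
      home-attached {v} v∉X att with v ∈? X | Fin.any? (attached? v)
      ... | yes v∈X | _ = contradiction v∈X v∉X
      ... | no _ | no ¬att = contradiction (_ , att) ¬att
      ... | no _ | yes (y , att′@(_ , _ , path , _)) =
        cong just (attached-unique (here (source∈ G path)) att′ att)

      home-≡ : ∀ {u} → u ∉ X → v ∉ X → (∀ x → Attached u x → Attached v x) →
               (∀ x → Attached v x → Attached u x) → home u ≡ home v
      home-≡ {v} {u} u∉X v∉X f g = by (Fin.any? (attached? u)) (Fin.any? (attached? v))
        where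
        none : ∀ {w} → w ∉ X → ¬ ∃ (Attached w) → home w ≡ nothing
        none {w} w∉X ¬att with w ∈? X | Fin.any? (attached? w)
        ... | yes w∈X | _ = contradiction w∈X w∉X
        ... | no _ | yes att = contradiction att ¬att
        ... | no _ | no _ = refl

        by : Dec (∃ (Attached u)) → Dec (∃ (Attached v)) → home u ≡ home v
        by (yes (x , att)) _ = trans (home-attached u∉X att) (≡.sym (home-attached v∉X (f x att)))
        by (no _) (yes (x , att)) = trans (home-attached u∉X (g x att)) (≡.sym (home-attached v∉X att))
        by (no ¬att) (no ¬att′) = trans (none u∉X ¬att) (≡.sym (none v∉X ¬att′))

      ranked⇒rooted : Rooted home X U
      ranked⇒rooted = record
        { X⊆U = proj₁ ∘ X⁻
        ; X-free = λ K K⊆X c → odd-free k (λ v∈K → proj₁ (X⁻ (K⊆X v∈K))) c λ v∈K → proj₂ (X⁻ (K⊆X v∈K))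
        ; home-own = home-own′
        ; home-X = λ _ → home-just
        ; home-adj = adj
        }
        where
        adj : ∀ {u v} → u ∈ U → v ∈ U → Edge G u v → home u ≡ home v ⊎ (u ∈ X × v ∈ X)
        adj {u} {v} u∈U v∈U e = by (u ∈? X) (v ∈? X)
          where
          by : Dec (u ∈ X) → Dec (v ∈ X) → home u ≡ home v ⊎ (u ∈ X × v ∈ X)
          by (yes u∈X) (yes v∈X) = inj₂ (u∈X , v∈X)
          by (yes u∈X) (no v∉X) = inj₁ (trans (home-own′ u∈X)
            (≡.sym (home-attached v∉X (u∈X , v , here (∈B v∈U v∉X) , edge-sym G e))))
          by (no u∉X) (yes v∈X) = inj₁ (trans (home-attached u∉X (v∈X , u , here (∈B u∈U u∉X) , e))
            (≡.sym (home-own′ v∈X)))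
          by (no u∉X) (no v∉X) = inj₁ (home-≡ u∉X v∉X
            (λ x (x∈X , c , p , e′) → x∈X , c , there (∈B v∈U v∉X) (edge-sym G e) p , e′)
            (λ x (x∈X , c , p , e′) → x∈X , c , there (∈B u∈U u∉X) e p , e′))

    mutual
      bounded-low : ∀ k {U} → Ranked G t r U → (∀ {v} → v ∈ U → r v < double k) → Bounded (lowBound t k) U
      bounded-low zero ranked r< = bounded-empty (λ _ → s≤s z≤n) λ (v , v∈U) → contradiction (r< v∈U) λ ()
      bounded-low (suc k) {U} ranked r< =
        bounded-root {e = highBound t k} {d = lowBound t (suc k)}
          2≤t (λ j → ≤-refl) (ranked⇒rooted {k} ranked r<)
          λ D⊆U D∌X → bounded-high k (ranked-⊆ G D⊆U ranked)
            λ v∈D → proj₂ (∈belowRank⁻ (∈B {k} ranked r< (D⊆U v∈D) (D∌X v∈D)))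

      bounded-high : ∀ k {U} → Ranked G t r U → (∀ {v} → v ∈ U → r v < suc (double k)) →
                     Bounded (highBound t k) U
      bounded-high k {U} ranked r< = bounded-extend {U′ = belowRank r (double k) U}
        {f = lowBound t k} (λ j → ≤-refl) (proj₁ ∘ ∈belowRank⁻) lift
        (bounded-low k (ranked-⊆ G (proj₁ ∘ ∈belowRank⁻) ranked) (proj₂ ∘ ∈belowRank⁻))
        where
        -- By `even-free`, no t-clique of `U` has a vertex of the top rank `double k`.
        lift : ∀ {S} → HitsCliques (belowRank r (double k) U) S → HitsCliques U S
        lift hits K K⊆U c = hits K (λ v∈K → ∈belowRank⁺ (K⊆U v∈K) (≤∧≢⇒< (s≤s⁻¹ (r< (K⊆U v∈K)))
          λ rv → Ranked.even-free ranked k K⊆U c v∈K rv λ u∈K → s≤s⁻¹ (r< (K⊆U u∈K)))) c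

_∈ˡ?_ : ∀ (Z : Subset n) F → Dec (Z ∈ˡ F)
_∈ˡ?_ = DecMembership._∈?_ (Vec.≡-dec Bool._≟_)

-- Comparison with β

-- Exponent of 2 ^ t in the estimate of highBound t k (suc j).
exponent : ℕ → ℕ → ℕ
exponent zero j = j
exponent (suc k) zero = suc (exponent k 1)
exponent (suc k) (suc j) = exponent (suc k) j + (3 + j + exponent k (suc (suc j)))

exponent-mono : ∀ k j → exponent k j ≤ exponent k (suc j)
exponent-mono zero j = n≤1+n j
exponent-mono (suc k) j = m≤m+n _ _

n<2^n : ∀ n → n < 2 ^ n
n<2^n zero = s≤s z≤n
n<2^n (suc n) = begin-strict
  suc n            ≡⟨ +-comm 1 n ⟩
  n + 1            <⟨ +-mono-<-≤ (n<2^n n) (m^n>0 2 n) ⟩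
  2 ^ n + 2 ^ n    ≡⟨ cong (2 ^ n +_) (+-identityʳ (2 ^ n)) ⟨
  2 ^ suc n        ∎
  where open ≤-Reasoning

-- Equality at 3. The left side is the factor of the root recurrence when all its terms are bounded
-- by one power.
2+2n≤2^n : ∀ n → 3 ≤ n → 2 + 2 * n ≤ 2 ^ n
2+2n≤2^n n 3≤n = subst (λ n → 2 + 2 * n ≤ 2 ^ n) (m∸n+n≡m 3≤n) (go (n ∸ 3))
  where
  open ≤-Reasoning
  go : ∀ m → 2 + 2 * (m + 3) ≤ 2 ^ (m + 3)
  go zero = ≤-refl
  go (suc m) = begin
    2 + 2 * suc (m + 3)                  ≡⟨ cong (2 +_) (*-suc 2 (m + 3)) ⟩
    2 + (2 + 2 * (m + 3))                ≤⟨ +-monoˡ-≤ _ (m≤m+n 2 (2 * (m + 3))) ⟩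
    (2 + 2 * (m + 3)) + (2 + 2 * (m + 3)) ≤⟨ +-mono-≤ (go m) (go m) ⟩
    2 ^ (m + 3) + 2 ^ (m + 3)            ≡⟨ cong (2 ^ (m + 3) +_) (+-identityʳ (2 ^ (m + 3))) ⟨
    2 ^ suc (m + 3)                      ∎

module _ (t : ℕ) (3≤t : 3 ≤ t) where

  open ≤-Reasoning

  private
    y : ℕ
    y = 2 ^ t

    instance
      y≢0 : NonZero y
      y≢0 = m^n≢0 2 t

    2+2t≤y : 2 + 2 * t ≤ y
    2+2t≤y = 2+2n≤2^n t 3≤t

    1+tz≤yz : ∀ z → 0 < z → suc (t * z) ≤ y * z
    1+tz≤yz z 0<z = begin
      1 + t * z      ≤⟨ +-monoˡ-≤ (t * z) 0<z ⟩
      suc t * z      ≤⟨ *-monoˡ-≤ z (≤-trans (s≤s (≤-trans (m≤m+n t _) (n≤1+n _))) 2+2t≤y) ⟩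
      y * z          ∎

  lowBound≤ : ∀ k → (∀ j → highBound t k (suc j) ≤ y ^ exponent k j) →
              ∀ j → lowBound t (suc k) j ≤ y ^ (j + exponent k j)
  lowBound≤ k high≤ zero = z≤n
  lowBound≤ k high≤ (suc j) = begin
    1 + t * (highBound t k (suc j) + lowBound t (suc k) j) + highBound t k (suc (suc j))
      ≤⟨ +-mono-≤ (+-mono-≤ (m^n>0 y (j + exponent k (suc j))) (*-monoʳ-≤ t (+-mono-≤
           (≤-trans (high≤ j) (^-monoʳ-≤ y (≤-trans (exponent-mono k j) (m≤n+m _ j))))
           (≤-trans (lowBound≤ k high≤ j) (^-monoʳ-≤ y (+-monoʳ-≤ j (exponent-mono k j)))))))
           (≤-trans (high≤ (suc j)) (^-monoʳ-≤ y (m≤n+m _ j))) ⟩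
    N + t * (N + N) + N
      ≡⟨ solve 2 (λ t N → N :+ t :* (N :+ N) :+ N := (con 2 :+ con 2 :* t) :* N) refl t N ⟩
    (2 + 2 * t) * N
      ≤⟨ *-monoˡ-≤ N 2+2t≤y ⟩
    y ^ (suc j + exponent k (suc j)) ∎
    where
    open +-*-Solver
    N = y ^ (j + exponent k (suc j))

  highBound≤ : ∀ k j → highBound t k (suc j) ≤ y ^ exponent k j
  highBound≤ zero zero = ≤-reflexive (trans (*-identityˡ _) (cong suc (*-zeroʳ t)))
  highBound≤ zero (suc j) = begin
    1 * suc (t * highBound t zero (suc j))  ≡⟨ *-identityˡ _ ⟩
    suc (t * highBound t zero (suc j))      ≤⟨ s≤s (*-monoʳ-≤ t (highBound≤ zero j)) ⟩
    suc (t * y ^ j)                         ≤⟨ 1+tz≤yz (y ^ j) (m^n>0 y j) ⟩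
    y ^ suc j                               ∎
  highBound≤ (suc k) zero = begin
    lowBound t (suc k) 1 * suc (t * 0)  ≡⟨ cong (λ z → lowBound t (suc k) 1 * suc z) (*-zeroʳ t) ⟩
    lowBound t (suc k) 1 * 1            ≡⟨ *-identityʳ _ ⟩
    lowBound t (suc k) 1                ≤⟨ lowBound≤ k (highBound≤ k) 1 ⟩
    y ^ suc (exponent k 1)              ∎
  -- `lowBound` contributes `2 + j + exponent k (2 + j)` and the branching over `t` vertices one
  -- more: the summand `3 + j` of `exponent`.
  highBound≤ (suc k) (suc j) = begin
    lowBound t (suc k) (2 + j) * suc (t * highBound t (suc k) (suc j))
      ≤⟨ *-mono-≤ (lowBound≤ k (highBound≤ k) (2 + j)) (s≤s (*-monoʳ-≤ t (highBound≤ (suc k) j))) ⟩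
    y ^ (2 + j + exponent k (2 + j)) * suc (t * y ^ exponent (suc k) j)
      ≤⟨ *-monoʳ-≤ (y ^ (2 + j + exponent k (2 + j))) (1+tz≤yz (y ^ exponent (suc k) j) (m^n>0 y (exponent (suc k) j))) ⟩
    y ^ (2 + j + exponent k (2 + j)) * y ^ suc (exponent (suc k) j)
      ≡⟨ ^-distribˡ-+-* y (2 + j + exponent k (2 + j)) (suc (exponent (suc k) j)) ⟨
    y ^ (2 + j + exponent k (2 + j) + suc (exponent (suc k) j))
      ≡⟨ cong (y ^_) (trans (+-comm (2 + j + exponent k (2 + j)) (suc (exponent (suc k) j)))
                            (≡.sym (+-suc (exponent (suc k) j) (2 + j + exponent k (2 + j))))) ⟩
    y ^ exponent (suc k) (suc j) ∎

  -- Weights are balanced: doubling per unit of excess makes the term at `j` half of the total, the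
  -- factor 8 per depth makes `exponent k (2 + j)` a quarter, and the last quarter absorbs `3 + j`.
  exponent≤ : ∀ k j → exponent k j ≤ 2 * (8 ^ k * 2 ^ j)
  exponent≤ zero j = ≤-trans (<⇒≤ (n<2^n j)) (≤-trans (≤-reflexive (≡.sym (*-identityˡ _))) (m≤m+n _ _))
  exponent≤ (suc k) zero = begin
    1 + exponent k 1          ≤⟨ +-mono-≤ (m^n>0 8 k) (exponent≤ k 1) ⟩
    8 ^ k + 2 * (8 ^ k * 2)   ≤⟨ m≤m+n _ (11 * 8 ^ k) ⟩
    8 ^ k + 2 * (8 ^ k * 2) + 11 * 8 ^ k
      ≡⟨ solve 1 (λ w → w :+ con 2 :* (w :* con 2) :+ con 11 :* w := con 2 :* (con 8 :* w :* con 1)) refl (8 ^ k) ⟩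
    2 * (8 ^ suc k * 1)       ∎
    where open +-*-Solver
  exponent≤ (suc k) (suc j) = begin
    exponent (suc k) j + (3 + j + exponent k (2 + j))
      ≤⟨ +-mono-≤ (exponent≤ (suc k) j) (+-mono-≤ 3+j≤ (exponent≤ k (2 + j))) ⟩
    2 * (8 ^ suc k * 2 ^ j) + (8 * (8 ^ k * 2 ^ j) + 2 * (8 ^ k * 2 ^ (2 + j)))
      ≡⟨ solve 2 (λ w z → con 2 :* (con 8 :* w :* z) :+ (con 8 :* (w :* z) :+ con 2 :* (w :* (con 2 :* (con 2 :* z))))
                   := con 2 :* (con 8 :* w :* (con 2 :* z))) refl (8 ^ k) (2 ^ j) ⟩
    2 * (8 ^ suc k * 2 ^ suc j) ∎
    where
    open +-*-Solver
    3+j≤ : 3 + j ≤ 8 * (8 ^ k * 2 ^ j)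
    3+j≤ = begin
      3 + j                  ≤⟨ +-mono-≤ (*-monoʳ-≤ 3 (m^n>0 2 j)) (<⇒≤ (n<2^n j)) ⟩
      3 * 2 ^ j + 2 ^ j      ≡⟨ +-comm (3 * 2 ^ j) _ ⟩
      4 * 2 ^ j              ≤⟨ *-monoˡ-≤ (2 ^ j) (s≤s (s≤s (s≤s (s≤s (z≤n {4}))))) ⟩
      8 * 2 ^ j              ≤⟨ *-monoʳ-≤ 8 (m≤n*m (2 ^ j) (8 ^ k) {{m^n≢0 8 k}}) ⟩
      8 * (8 ^ k * 2 ^ j)    ∎

  8≤β1 : 8 ≤ β 1 t
  8≤β1 = ^-monoʳ-≤ 2 (≤-trans 3≤t (≤-reflexive (≡.sym (*-identityʳ t))))

  -- A single exponential against a tower: only the base is numerical, `2 ^ 10` against an exponent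
  -- of at least 24.
  2*8^≤β : ∀ k → 2 * 8 ^ (3 + k) ≤ β (2 + k) t
  2*8^≤β zero = ^-monoʳ-≤ 2 {10} (≤-trans (m≤m+n 10 14) (*-mono-≤ 3≤t 8≤β1))
  2*8^≤β (suc k) = begin
    2 * (8 * 8 ^ (3 + k))   ≡⟨ solve 1 (λ w → con 2 :* (con 8 :* w) := con 8 :* (con 2 :* w)) refl (8 ^ (3 + k)) ⟩
    2 ^ 3 * (2 * 8 ^ (3 + k)) ≤⟨ *-monoʳ-≤ 8 (2*8^≤β k) ⟩
    2 ^ 3 * b               ≤⟨ *-monoʳ-≤ 8 (<⇒≤ (n<2^n b)) ⟩
    2 ^ 3 * 2 ^ b           ≡⟨ ^-distribˡ-+-* 2 3 b ⟨
    2 ^ (3 + b)             ≤⟨ ^-monoʳ-≤ 2 3+b≤tb ⟩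
    2 ^ (t * b)             ∎
    where
    open +-*-Solver
    b = β (2 + k) t
    2≤b : 2 ≤ b
    2≤b = ≤-trans (*-monoʳ-≤ 2 (m^n>0 8 (3 + k))) (2*8^≤β k)
    3+b≤tb : 3 + b ≤ t * b
    3+b≤tb = begin
      3 + b        ≡⟨ +-comm 3 b ⟩
      b + 3        ≤⟨ +-monoʳ-≤ b (≤-trans (n≤1+n 3) (*-monoʳ-≤ 2 2≤b)) ⟩
      3 * b        ≤⟨ *-monoˡ-≤ b 3≤t ⟩
      t * b        ∎

  exponent≤β : ∀ k → exponent (2 + k) 0 ≤ β (suc k) t
  -- `exponent 2 0` evaluates to 8, which is `2 ^ t` at `t = 3`; the general estimate would give
  -- 128.
  exponent≤β zero = 8≤β1
  exponent≤β (suc k) = ≤-trans (exponent≤ (3 + k) 0)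
    (≤-trans (≤-reflexive (cong (2 *_) (*-identityʳ (8 ^ (3 + k))))) (2*8^≤β k))

  highBound≤β : ∀ x → highBound t x 1 ≤ β x t
  highBound≤β zero = highBound≤ zero zero
  -- The exact value `2 + 2 * t` is used, since the estimate by `exponent` would give `y ^ 2`.
  highBound≤β (suc zero) = ≤-trans (≤-reflexive
    (solve 1 (λ t → (con 1 :+ t :* (con 1 :* (con 1 :+ t :* con 0) :+ con 0)
                      :+ con 1 :* (con 1 :+ t :* (con 1 :* (con 1 :+ t :* con 0)))) :* (con 1 :+ t :* con 0)
                    := con 2 :+ con 2 :* t) refl t))
    (≤-trans 2+2t≤y (≤-reflexive (cong (2 ^_) (≡.sym (*-identityʳ t)))))
    where open +-*-Solver
  highBound≤β (suc (suc k)) = begin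
    highBound t (2 + k) 1          ≤⟨ highBound≤ (2 + k) 0 ⟩
    y ^ exponent (2 + k) 0         ≡⟨ ^-*-assoc 2 t _ ⟩
    2 ^ (t * exponent (2 + k) 0)   ≤⟨ ^-monoʳ-≤ 2 (*-monoʳ-≤ t (exponent≤β k)) ⟩
    β (2 + k) t                    ∎

-- From extracted sets to blocking sets

unique-⊆⇒length≤ : {A : Set} {xs ys : List A} → Unique xs → (∀ {x} → x ∈ˡ xs → x ∈ˡ ys) →
                   length xs ≤ length ys
unique-⊆⇒length≤ {xs = []} _ _ = z≤n
unique-⊆⇒length≤ {xs = x ∷ xs} uniq@(_ ∷ uniq′) sub with ∈-∃++ (sub (here refl))
... | as , bs , refl = begin
  suc (length xs)           ≤⟨ s≤s (unique-⊆⇒length≤ uniq′ sub′) ⟩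
  suc (length (as ++ bs))   ≡⟨ cong suc (length-++ as) ⟩
  suc (length as + length bs) ≡⟨ +-suc (length as) (length bs) ⟨
  length as + suc (length bs) ≡⟨ length-++ as ⟨
  length (as ++ x ∷ bs)     ∎
  where
  open ≤-Reasoning
  sub′ : ∀ {z} → z ∈ˡ xs → z ∈ˡ as ++ bs
  sub′ {z} z∈xs with ∈-++⁻ as (sub (there z∈xs))
  ... | inj₁ z∈as = ∈-++⁺ˡ z∈as
  ... | inj₂ (here refl) = contradiction z∈xs (Unique[x∷xs]⇒x∉xs uniq)
  ... | inj₂ (there z∈bs) = ∈-++⁺ʳ as z∈bs

module _ {n} (G : Graph n) {t : ℕ} (3≤t : 3 ≤ t) where

  hits⇒meets : ∀ {S Z} → Hits G S Z → Meets S Z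
  hits⇒meets (v , v∈) = v , ∈∩⁻ v∈

  meets⇒hits : ∀ {S Z} → Meets S Z → Hits G S Z
  meets⇒hits (v , v∈) = v , x∈p∩q⁺ v∈

  hitsAll? : ∀ F → Decidable (HitsAll G t F)
  hitsAll? F S = (allSubsets? λ K → T-clique? G t K →-dec nonempty? (S ∩ K)) ×-dec
                 (allSubsets? λ Z → (Z ∈ˡ? F) →-dec nonempty? (S ∩ Z))

  module _ (path? : ∀ U u v → Dec (PathIn G U u v)) {x} (bed : BedLe G t ⊤ x)
    {F B : List (Subset n)} (validF : ValidFamily G t F) (validB : ValidFamily G t B)
    {k k′} (optF : OptIs G t F k) (opt[] : OptIs G t [] k) (optFB : OptIs G t (F ++ B) k′) (k<k′ : k < k′) where

    private
      H : Subset n → Set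
      H Z = TClique G t Z ⊎ (Z ∈ˡ F ⊎ Z ∈ˡ B)

      H? : Decidable H
      H? Z = T-clique? G t Z ⊎-dec ((Z ∈ˡ? F) ⊎-dec (Z ∈ˡ? B))

      H-clique : ∀ {Z} → H Z → IsClique G Z
      H-clique (inj₁ (clique , _)) = clique
      H-clique (inj₂ (inj₁ Z∈F)) = proj₂ (proj₂ (All.lookup validF Z∈F))
      H-clique (inj₂ (inj₂ Z∈B)) = proj₂ (proj₂ (All.lookup validB Z∈B))

      H-size : ∀ {Z} → H Z → ∣ Z ∣ ≤ t
      H-size (inj₁ (_ , ∣Z∣≡t)) = ≤-reflexive ∣Z∣≡t
      H-size (inj₂ (inj₁ Z∈F)) = <⇒≤ (proj₁ (proj₂ (All.lookup validF Z∈F)))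
      H-size (inj₂ (inj₂ Z∈B)) = <⇒≤ (proj₁ (proj₂ (All.lookup validB Z∈B)))

      2≤t : 2 ≤ t
      2≤t = ≤-trans (s≤s (s≤s z≤n)) 3≤t

      0<t : 0 < t
      0<t = ≤-trans (s≤s z≤n) 2≤t

    open Hitting G t 0<t H H? H-clique H-size inj₁
    open Rank G 0<t path?

    cost≥1+k : Cost≥ ⊤ ⊥ (suc k)
    cost≥1+k S (_ , hits , sol) = ≤-trans k<k′ (proj₂ optFB S
      ((λ K c → meets⇒hits (hits K ⊆⊤ c)) , λ Z Z∈ → meets⇒hits (unbot (sol Z (inj₂ (∈-++⁻ F Z∈))))))
      where
      unbot : ∀ {Z} → Meets (⊥ ∪ S) Z → Meets S Z
      unbot (v , v∈ , v∈Z) = v , [ (λ v∈⊥ → contradiction v∈⊥ ∉⊥) , id ]′ (∈∪⁻ v∈) , v∈Z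

    -- Cleanness enters here: the t-cliques alone force `k`, so cost `suc k` is an excess of only 1.
    k≤opt : k ≤ opt ⊤
    k≤opt = let S , _ , hits , ∣S∣≤ = optimal ⊤ in
      ≤-trans (proj₂ opt[] S ((λ K c → meets⇒hits (hits K ⊆⊤ c)) , λ _ ())) ∣S∣≤

    -- Members of `L` that are t-cliques or lie in `F` are hit by every competitor anyway, so
    -- keeping those in `B` preserves the forced cost.
    smallBlocking : ∃ λ B′ → (∀ Z → Z ∈ˡ B′ → Z ∈ˡ B) × length B′ ≤ β x t × Blocking G t F B′
    smallBlocking with bedLe⇒ranking bed
    ... | r , ranked , r≤ with bounded-high G path? t 2≤t H H? H-clique H-size inj₁ x ranked (s≤s ∘ r≤)
                                 1 ⊥ (suc k) (λ v∈⊥ → contradiction v∈⊥ ∉⊥)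
                                 (≤-trans (s≤s k≤opt) (≤-reflexive (+-comm 1 _))) cost≥1+k
    ...   | L , L⊆H , ∣L∣≤ , costL = B′ , (λ _ → B′⊆B) ,
      ≤-trans (length-filter (_∈ˡ? B) L) (≤-trans ∣L∣≤ (highBound≤β t 3≤t x)) ,
      All.tabulate (All.lookup validB ∘ B′⊆B) , k , ∣ S ∣ , optF , ((S , hitsAll , refl) , S-least) ,
      costL S (⊆⊤ , (λ K _ c → hits⇒meets (proj₁ hitsAll K c)) , λ Z Z∈L →
        let v , v∈S , v∈Z = hits⇒meets (hitsL Z∈L (L⊆H Z∈L)) in v , ∈∪ʳ v∈S , v∈Z)
      where
      B′ : List (Subset n)
      B′ = filter (_∈ˡ? B) L

      B′⊆B : ∀ {Z} → Z ∈ˡ B′ → Z ∈ˡ B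
      B′⊆B Z∈ = proj₂ (∈-filter⁻ (_∈ˡ? B) {xs = L} Z∈)

      best : ∃ λ S → HitsAll G t (F ++ B′) S × (∀ S′ → HitsAll G t (F ++ B′) S′ → ∣ S ∣ ≤ ∣ S′ ∣)
      best = smallest (hitsAll? (F ++ B′)) (let S , (hits , hitsFB) , _ = proj₁ optFB in
        S , hits , λ Z Z∈ → hitsFB Z ([ ∈-++⁺ˡ , ∈-++⁺ʳ F ∘ B′⊆B ]′ (∈-++⁻ F Z∈)))

      S : Subset n
      S = proj₁ best

      hitsAll : HitsAll G t (F ++ B′) S
      hitsAll = proj₁ (proj₂ best)

      S-least : ∀ S′ → HitsAll G t (F ++ B′) S′ → ∣ S ∣ ≤ ∣ S′ ∣
      S-least = proj₂ (proj₂ best)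

      hitsL : ∀ {Z} → Z ∈ˡ L → H Z → Hits G S Z
      hitsL Z∈L (inj₁ c) = proj₁ hitsAll _ c
      hitsL Z∈L (inj₂ (inj₁ Z∈F)) = proj₂ hitsAll _ (∈-++⁺ˡ Z∈F)
      hitsL Z∈L (inj₂ (inj₂ Z∈B)) = proj₂ hitsAll _ (∈-++⁺ʳ F (∈-filter⁺ (_∈ˡ? B) Z∈L Z∈B))

theorem9 : (t : ℕ) → 3 ≤ t → (n : ℕ) (G : Graph n) (x : ℕ) → BedIs G t ⊤ x
    → (F B : List (Subset n)) → Clean G t F → MinimalBlocking G t F B → Unique B
    → length B ≤ β x t
theorem9 t 3≤t n G x (bed , _) F B (validF , k₀ , optF₀ , opt[])
  ((validB , k , k′ , optF , optFB , k<k′) , minimal) unique =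
  decidable-stable (length B ≤? β x t) λ ¬bound →
  -- The goal is stable, so the existence of paths may be decided classically.
  ¬¬-∀-Subset (λ U → ¬¬-∀-Fin λ u → ¬¬-∀-Fin λ v → ¬¬-excluded-middle {A = PathIn G U u v}) λ path? →
  ¬bound
    (let B′ , B′⊆B , ∣B′∣≤ , blocking = smallBlocking G 3≤t path? bed validF validB optF
           (subst (OptIs G t []) k₀≡k opt[]) optFB k<k′
     -- Minimality puts all of `B` inside `B′`, and `B` has no repetitions.
     in ≤-trans (unique-⊆⇒length≤ unique (minimal B′ B′⊆B blocking _)) ∣B′∣≤)
  where
  optIs-unique : ∀ {k k₀} → OptIs G t F k → OptIs G t F k₀ → k₀ ≤ k
  optIs-unique ((S , hits , refl) , _) (_ , least) = least S hits

  k₀≡k : k₀ ≡ k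
  k₀≡k = ≤-antisym (optIs-unique optF optF₀) (optIs-unique optF₀ optF)
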